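{- For every $n\geq 4$, the star graph $S_n$ is an independent element in the poset $\mathcal{S}_n$.
   Context: All graphs are finite and simple. The star $S_n$ ($n\ge4$) is the graph on vertex set $\{1,\dots,n\}$ whose edges join $n$ to each $j\in\{1,\dots,n-1\}$. The chromatic symmetric function of a graph $G$ with vertices $v_1,\dots,v_n$ is $X_G=\sum_{\kappa}x_{\kappa(v_1)}\cdots x_{\kappa(v_n)}$, summed over all proper colorings $\kappa:V(G)\to\{1,2,3,\dots\}$; it is a homogeneous symmetric function of degree $n$ over $\mathbb{Q}$. Let $s_\lambda$ be the Schur symmetric functions; $[s_\lambda]F$ denotes the coefficient of $s_\lambda$ in $F$ expanded in this basis, and $F$ is Schur-positive if $[s_\lambda]F\ge 0$ for all $\lambda$. For connected graphs $G,H$ on $n$ vertices (for which $[s_{(1^n)}]X_G$ and $[s_{(1^n)}]X_H$ are positive), set $$X_s(G,H)=X_G-\frac{[s_{(1^n)}]X_G}{[s_{(1^n)}]X_H}X_H.$$ $\mathcal{S}_n$ is the poset (not to be confused with the star $S_n$) whose elements are the equivalence classes of connected graphs on $n$ vertices under $G\sim H\iff X_G=X_H$, ordered by $G\geq_s H$ if and only if $X_s(G,H)$ is Schur-positive. An element of a poset is called independent if it is not comparable to any other element of the poset. -}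

module Defs where

open import Data.Fin using (Fin; toℕ; fromℕ)
import Data.Fin.Properties as Fin
open import Data.Integer using (+_)
open import Data.List using (List; []; _∷_; length; map; filter; foldr; concat; concatMap;
  replicate; upTo; cartesianProductWith)
open import Data.List.Properties using (≡-dec)
open import Data.List.Relation.Binary.Prefix.Heterogeneous using (Prefix)
open import Data.List.Relation.Binary.Prefix.Heterogeneous.Properties using (prefix?)
open import Data.List.Relation.Unary.All as All using (All)
open import Data.List.Relation.Unary.Linked using (Linked; linked?)
open import Data.Nat as ℕ using (ℕ; zero; suc)
open import Data.Nat.ListAction using (sum)
open import Data.Product using (Σ-syntax; _×_; _,_)
open import Data.Rational as ℚ using (ℚ; 0ℚ; _/_)
import Data.Rational.Properties as ℚ
open import Data.Sum using (_⊎_; inj₁; inj₂; swap)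
open import Data.Vec as Vec using (Vec; lookup; toList)
open import Level using (0ℓ)
open import Relation.Binary using (Rel; Symmetric; Irreflexive; Decidable)
open import Relation.Binary.Bundles.Raw using (RawRelation)
open import Relation.Binary.Construct.Closure.ReflexiveTransitive using (Star; ε; _◅_)
open import Relation.Binary.PropositionalEquality using (_≡_; _≢_; refl; sym; cong; _≗_)
open import Relation.Nullary using (¬_; yes; no; ¬?; _×-dec_; _⊎-dec_; _→-dec_)
open import Relation.Unary using () renaming (Decidable to Decidable₁)

record Graph (n : ℕ) : Set₁ where
  field
    Adj    : Rel (Fin n) 0ℓ
    adj?   : Decidable Adj
    symm   : Symmetric Adj
    irrefl : Irreflexive _≡_ Adj

open Graph public

-- `Star R` is the library's reflexive-transitive closure: here, walks.
Connected : ∀ {n} → Graph n → Set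
Connected G = ∀ u v → Star (Adj G) u v

record ConnectedGraph (n : ℕ) : Set₁ where
  field
    graph     : Graph n
    connected : Connected graph

open ConnectedGraph public

-- The vertices 1,…,n are 0,…,n-1 here, so the centre n is the vertex n-1.
IsCentre : ∀ {n} → Fin n → Set
IsCentre {n} i = suc (toℕ i) ≡ n

isCentre? : ∀ {n} → Decidable₁ (IsCentre {n})
isCentre? {n} i = suc (toℕ i) ℕ.≟ n

starGraph : ∀ n → Graph n
starGraph n = record
  { Adj    = λ i j → i ≢ j × (IsCentre i ⊎ IsCentre j)
  ; adj?   = λ i j → ¬? (i Fin.≟ j) ×-dec (isCentre? i ⊎-dec isCentre? j)
  ; symm   = λ (i≢j , c) → (λ j≡i → i≢j (sym j≡i)) , swap c
  ; irrefl = λ i≡j (i≢j , _) → i≢j i≡j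
  }

starGraph-connected : ∀ n → Connected (starGraph n)
starGraph-connected (suc m) u v with u Fin.≟ v
... | yes refl = ε
... | no u≢v with isCentre? u | isCentre? v
...   | yes cu | _      = (u≢v , inj₁ cu) ◅ ε
...   | no _   | yes cv = (u≢v , inj₂ cv) ◅ ε
...   | no ¬cu | no ¬cv =
  ((λ { refl → ¬cu centre }) , inj₂ centre) ◅ ((λ { refl → ¬cv centre }) , inj₁ centre) ◅ ε
  where
  centre : IsCentre (fromℕ m)
  centre = cong suc (Fin.toℕ-fromℕ m)

starC : ∀ n → ConnectedGraph n
starC n = record { graph = starGraph n ; connected = starGraph-connected n }

-- Formal power series over ℚ in x₀, x₁, x₂, …, given by their coefficients: the list
-- α₀ ∷ … ∷ αₖ₋₁ ∷ [] stands for the monomial x₀^α₀ ⋯ xₖ₋₁^αₖ₋₁.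

Series : Set
Series = List ℕ → ℚ

-- A word w over ℕ contributes the monomial ∏ x_(w i).  Words with monomial α only use letters
-- below length α, which is why the enumerations below range over finite alphabets.
HasMonomial : List ℕ → List ℕ → Set
HasMonomial α w = map (λ c → length (filter (c ℕ.≟_) w)) (upTo (length α)) ≡ α

hasMonomial? : ∀ α → Decidable₁ (HasMonomial α)
hasMonomial? α w = ≡-dec ℕ._≟_ _ α

fromℕℚ : ℕ → ℚ
fromℕℚ m = + m / 1

count : ∀ {A : Set} {P : A → Set} → Decidable₁ P → List A → ℚ
count P? xs = fromℕℚ (length (filter P? xs))

words : ∀ {A : Set} → List A → ∀ m → List (Vec A m)
words A zero    = Vec.[] ∷ []
words A (suc m) = cartesianProductWith Vec._∷_ A (words A m)

Proper : ∀ {n} → Graph n → Vec ℕ n → Set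
Proper G κ = ∀ u v → Adj G u v → lookup κ u ≢ lookup κ v

proper? : ∀ {n} (G : Graph n) → Decidable₁ (Proper G)
proper? G κ = Fin.all? λ u → Fin.all? λ v →
  adj? G u v →-dec ¬? (lookup κ u ℕ.≟ lookup κ v)

X : ∀ {n} → Graph n → Series
X {n} G α =
  count (λ κ → proper? G κ ×-dec hasMonomial? α (toList κ)) (words (upTo (length α)) n)

infix 4 _⊢_

_⊢_ : List ℕ → ℕ → Set
μ ⊢ n = sum μ ≡ n × All (1 ℕ.≤_) μ × Linked ℕ._≥_ μ

_⊢?_ : Decidable _⊢_
μ ⊢? n = (sum μ ℕ.≟ n) ×-dec (All.all? (1 ℕ.≤?_) μ ×-dec linked? ℕ._≥?_ μ)

-- A partition of n has at most n parts, each between 1 and n.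
partitions : ℕ → List (List ℕ)
partitions n = filter (_⊢? n)
  (concatMap (λ ℓ → map toList (words (map suc (upTo n)) ℓ)) (upTo (suc n)))

-- The fillings, with entries below k, of the Young diagram of μ (the list of its rows).
fillings : ℕ → List ℕ → List (List (List ℕ))
fillings k []      = [] ∷ []
fillings k (m ∷ μ) = cartesianProductWith _∷_ (map toList (words (upTo k) m)) (fillings k μ)

-- `Prefix ℕ._>_ lower upper`: each entry of `lower` exceeds the entry of `upper` above it.
Semistandard : List (List ℕ) → Set
Semistandard T = All (Linked ℕ._≤_) T × Linked (λ upper lower → Prefix ℕ._>_ lower upper) T

semistandard? : Decidable₁ Semistandard
semistandard? T = All.all? (linked? ℕ._≤?_) T ×-dec
  linked? (λ upper lower → prefix? ℕ._>?_ lower upper) T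

-- s μ is the Schur function when μ is a partition: the generating function of the semistandard
-- Young tableaux of shape μ.
s : List ℕ → Series
s μ α = count (λ T → semistandard? T ×-dec hasMonomial? α (concat T)) (fillings (length α) μ)

∑ : List ℚ → ℚ
∑ = foldr ℚ._+_ 0ℚ

-- The expansion of F, homogeneous of degree n, in the Schur basis; coeff μ is [s_μ] F.
-- The values of coeff at lists that are not partitions of n play no role.
record SchurExpansion (n : ℕ) (F : Series) : Set where
  field
    coeff   : List ℕ → ℚ
    expands : ∀ α → F α ≡ ∑ (map (λ μ → coeff μ ℚ.* s μ α) (partitions n))

open SchurExpansion public

SchurPositive : ℕ → Series → Set
SchurPositive n F = Σ[ e ∈ SchurExpansion n F ] (∀ μ → μ ⊢ n → 0ℚ ℚ.≤ coeff e μ)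

-- p / q, totalised by the value 0 at q = 0.
ratio : ℚ → ℚ → ℚ
ratio p q with q ℚ.≟ 0ℚ
... | yes _  = 0ℚ
... | no q≢0 = ℚ._÷_ p q {{ℚ.≢-nonZero q≢0}}

-- The denominator [s_(1ⁿ)] X_H is positive, so the junk value of `ratio` is not used.
Xₛ : ∀ {n} (G H : Graph n) → SchurExpansion n (X G) → SchurExpansion n (X H) → Series
Xₛ {n} G H a b α = X G α ℚ.- ratio (coeff a 1ⁿ) (coeff b 1ⁿ) ℚ.* X H α
  where
  1ⁿ : List ℕ
  1ⁿ = replicate n 1

-- The Schur functions form a basis, so the expansions of X_G and X_H exist and are unique.
_≥ₛ_ : ∀ {n} → Rel (ConnectedGraph n) 0ℓ
_≥ₛ_ {n} G H = Σ[ a ∈ SchurExpansion n (X (graph G)) ] Σ[ b ∈ SchurExpansion n (X (graph H)) ]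
  SchurPositive n (Xₛ (graph G) (graph H) a b)

-- Equivalence classes are represented by their members, with equality of chromatic symmetric
-- functions as the underlying equality.
𝒮 : ℕ → RawRelation _ _ _
𝒮 n = record
  { Carrier = ConnectedGraph n
  ; _≈_     = λ G H → X (graph G) ≗ X (graph H)
  ; _∼_     = _≥ₛ_
  }

module _ {c ℓ₁ ℓ₂} (P : RawRelation c ℓ₁ ℓ₂) where
  open RawRelation P

  Comparable : Rel Carrier ℓ₂
  Comparable x y = x ∼ y ⊎ y ∼ x

  Independent : Carrier → Set _
  Independent x = ∀ y → y ≉ x → ¬ Comparable x y

{-# OPTIONS --safe #-}

-- The functional Φ(F) = ∑_α (-1)^(n-ℓ(α)) [x^α] F, over the compositions α of n, is the
-- coefficient of s_(1ⁿ): on Schur functions a sign-reversing involution cancels all packed tableaux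
-- of a shape whose first row has at least two cells.  On X_G it is positive, by deleting a vertex
-- v: Φ(X_G) = Φ(X_{G-v}) + ∑ᵢ Φ(X_{Gᵢ}), where Gᵢ is G - v with the i-th neighbour of v joined to
-- the later ones.  So X_s subtracts a positive multiple of X_H.
--
-- Only stars have the monomial x^(n-1,1) in X: a colour class of n - 1 vertices leaves one vertex,
-- which connectedness joins to all others.  If H is not a star then X_s(H, Sₙ) has a negative
-- coefficient at x^(n-1,1), so it is not Schur-positive.  In X_s(Sₙ, H) the coefficient at
-- x^(n-1,1) is positive and the one at x^(n-2,2) is not, since two colours used twice or more cannot
-- colour a star; but a shape with K_{μ,(n-1,1)} > 0 has K_{μ,(n-2,2)} > 0.

module Submission where

open import Defs
open import Data.Nat using (ℕ; _≥_)

open import Algebra.Bundles using (CommutativeMonoid)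
open import Data.Fin using (Fin; zero; suc; fromℕ)
import Data.Fin.Properties as Fin
open import Data.Fin.Permutation.Components using (transpose; transpose-inverse)
open import Data.Integer as ℤ using (+_)
import Data.Integer.Properties as ℤ
open import Data.List as L using (List; []; _∷_; length; map; filter; concat; concatMap; upTo;
  _++_; allFin; replicate; take; drop)
import Data.List.Properties as List
open import Data.List.Membership.Propositional using (_∈_; _∉_; find; lose)
open import Data.List.Membership.Propositional.Properties
open import Data.List.Membership.Propositional.Properties.WithK using (unique∧set⇒bag)
open import Data.List.Relation.Binary.BagAndSetEquality using (∼bag⇒↭)
open import Data.List.Relation.Binary.Permutation.Propositional as ↭ using (_↭_; ↭-sym)
import Data.List.Relation.Binary.Permutation.Propositional.Properties as ↭
open import Data.List.Relation.Binary.Prefix.Heterogeneous using (Prefix; []; _∷_)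
open import Data.List.Relation.Unary.All as All using (All; []; _∷_)
import Data.List.Relation.Unary.All.Properties as All
open import Data.List.Relation.Unary.AllPairs using ([]; _∷_)
open import Data.List.Relation.Unary.Any using (here; there)
open import Data.List.Relation.Unary.Linked using (Linked; []; [-]; _∷_)
open import Data.List.Relation.Unary.Unique.Propositional using (Unique)
import Data.List.Relation.Unary.Unique.Propositional.Properties as Unique
open import Data.Nat as ℕ using (zero; suc)
open import Data.Nat.ListAction using (sum)
import Data.Nat.Properties as ℕ
open import Data.Product using (∃; _×_; _,_; proj₁; proj₂)
open import Data.Rational as ℚ using (ℚ; 0ℚ; 1ℚ)
import Data.Rational.Properties as ℚ
open import Data.Rational.Solver using (module +-*-Solver)
import Data.Rational.Unnormalised as ℚᵘ
import Data.Rational.Unnormalised.Properties as ℚᵘ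
open import Data.Sum using (_⊎_; inj₁; inj₂)
open import Data.Unit using (⊤; tt)
open import Data.Vec as Vec using (Vec; toList; lookup; tabulate)
import Data.Vec.Properties as Vec
open import Function using (_∘_; id; case_of_)
open import Function.Bundles using (mk⇔)
open import Relation.Binary.Construct.Closure.ReflexiveTransitive using (Star; ε; _◅_)
open import Relation.Binary.Definitions using (tri<; tri≈; tri>)
open import Relation.Binary.PropositionalEquality
open import Relation.Nullary using (¬_; ¬?; Dec; yes; no; contradiction)
open import Relation.Nullary.Decidable using (_×-dec_; _⊎-dec_)
open import Relation.Unary using (Decidable)
open import Algebra.Properties.AbelianGroup ℚ.+-0-abelianGroup using ()
  renaming (⁻¹-∙-comm to neg-+-comm; ⁻¹-involutive to neg-involutive)
open import Algebra.Properties.CommutativeSemigroup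
  (CommutativeMonoid.commutativeSemigroup ℚ.+-0-commutativeMonoid) using ()
  renaming (interchange to +-interchange)
open import Data.List.Membership.DecPropositional ℕ._≟_ using (_∈?_)

-- The coefficients at (1ⁿ) belong to expansions that are handed over as data, so their sign has to
-- be recovered from the series alone. A linear functional does this for any expansion as soon as it
-- is positive on X_G, vanishes on the wide shapes and is nonnegative on s_(1ⁿ). The graphs Gᵢ come
-- from a count of colours. When the deleted vertex is coloured last, a packed colouring of G - v
-- contributes 1 + d after cancellation, where d is the number of distinct colours on the neighbours
-- of v. Counting each colour at the last neighbour that carries it, the i-th neighbour contributes
-- when its colour differs from those of all later neighbours, and this is properness for Gᵢ. So d
-- dissolves into signed counts of graphs with one vertex less, and induction applies. The bound n ≥
-- 4 makes both exponents of x^(n-2,2) at least 2, so that either colour of the centre would have to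
-- be used twice.

private variable
  A B : Set

-- Finite sums over lists, and indicators

⅀ : List A → (A → ℚ) → ℚ
⅀ xs f = ∑ (map f xs)

⅀-cong : ∀ {f g : A → ℚ} xs → (∀ {x} → x ∈ xs → f x ≡ g x) → ⅀ xs f ≡ ⅀ xs g
⅀-cong []       eq = refl
⅀-cong (x ∷ xs) eq = cong₂ ℚ._+_ (eq (here refl)) (⅀-cong xs (eq ∘ there))

⅀-zero : ∀ {f : A → ℚ} xs → (∀ {x} → x ∈ xs → f x ≡ 0ℚ) → ⅀ xs f ≡ 0ℚ
⅀-zero []       eq = refl
⅀-zero (x ∷ xs) eq = cong₂ ℚ._+_ (eq (here refl)) (⅀-zero xs (eq ∘ there))

⅀-nonneg : ∀ {f : A → ℚ} xs → (∀ {x} → x ∈ xs → 0ℚ ℚ.≤ f x) → 0ℚ ℚ.≤ ⅀ xs f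
⅀-nonneg []       nn = ℚ.≤-refl
⅀-nonneg (x ∷ xs) nn = ℚ.+-mono-≤ (nn (here refl)) (⅀-nonneg xs (nn ∘ there))

⅀-positive : ∀ {f : A → ℚ} {x} xs → (∀ {y} → y ∈ xs → 0ℚ ℚ.≤ f y) → x ∈ xs → 0ℚ ℚ.< f x →
             0ℚ ℚ.< ⅀ xs f
⅀-positive (x ∷ xs) nn (here refl) pos = ℚ.+-mono-<-≤ pos (⅀-nonneg xs (nn ∘ there))
⅀-positive (y ∷ xs) nn (there x∈)  pos =
  ℚ.+-mono-≤-< (nn (here refl)) (⅀-positive xs (nn ∘ there) x∈ pos)

⅀-pos-witness : ∀ {f : A → ℚ} xs → 0ℚ ℚ.< ⅀ xs f → ∃ λ x → x ∈ xs × 0ℚ ℚ.< f x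
⅀-pos-witness []       0<0 = contradiction 0<0 (ℚ.<-irrefl refl)
⅀-pos-witness {f = f} (x ∷ xs) pos with 0ℚ ℚ.<? f x
... | yes 0<fx = x , here refl , 0<fx
... | no  0≮fx
  with y , y∈ , p ← ⅀-pos-witness xs (ℚ.<-≤-trans pos
         (ℚ.≤-trans (ℚ.+-monoˡ-≤ _ (ℚ.≮⇒≥ 0≮fx)) (ℚ.≤-reflexive (ℚ.+-identityˡ _))))
  = y , there y∈ , p

⅀-++ : ∀ (f : A → ℚ) xs ys → ⅀ (xs ++ ys) f ≡ ⅀ xs f ℚ.+ ⅀ ys f
⅀-++ f []       ys = sym (ℚ.+-identityˡ _)
⅀-++ f (x ∷ xs) ys =
  trans (cong (f x ℚ.+_) (⅀-++ f xs ys)) (sym (ℚ.+-assoc (f x) (⅀ xs f) (⅀ ys f)))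

⅀-concatMap : ∀ (f : B → ℚ) (g : A → List B) xs → ⅀ (concatMap g xs) f ≡ ⅀ xs (λ x → ⅀ (g x) f)
⅀-concatMap f g []       = refl
⅀-concatMap f g (x ∷ xs) =
  trans (⅀-++ f (g x) (concatMap g xs)) (cong (⅀ (g x) f ℚ.+_) (⅀-concatMap f g xs))

⅀-map : ∀ (f : B → ℚ) (g : A → B) xs → ⅀ (map g xs) f ≡ ⅀ xs (f ∘ g)
⅀-map f g xs = cong ∑ (sym (List.map-∘ xs))

⅀-+ : ∀ (f g : A → ℚ) xs → ⅀ xs (λ x → f x ℚ.+ g x) ≡ ⅀ xs f ℚ.+ ⅀ xs g
⅀-+ f g []       = refl
⅀-+ f g (x ∷ xs) = trans (cong (f x ℚ.+ g x ℚ.+_) (⅀-+ f g xs)) (+-interchange (f x) (g x) _ _)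

⅀-*ˡ : ∀ c (f : A → ℚ) xs → ⅀ xs (λ x → c ℚ.* f x) ≡ c ℚ.* ⅀ xs f
⅀-*ˡ c f []       = sym (ℚ.*-zeroʳ c)
⅀-*ˡ c f (x ∷ xs) =
  trans (cong (c ℚ.* f x ℚ.+_) (⅀-*ˡ c f xs)) (sym (ℚ.*-distribˡ-+ c (f x) (⅀ xs f)))

⅀-neg : ∀ (f : A → ℚ) xs → ⅀ xs (λ x → ℚ.- f x) ≡ ℚ.- ⅀ xs f
⅀-neg f []       = refl
⅀-neg f (x ∷ xs) = trans (cong (ℚ.- f x ℚ.+_) (⅀-neg f xs)) (neg-+-comm (f x) (⅀ xs f))

⅀-swap : ∀ (f : A → B → ℚ) xs ys →
         ⅀ xs (λ x → ⅀ ys (λ y → f x y)) ≡ ⅀ ys (λ y → ⅀ xs (λ x → f x y))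
⅀-swap f []       ys = sym (⅀-zero ys (λ _ → refl))
⅀-swap f (x ∷ xs) ys =
  trans (cong (⅀ ys (f x) ℚ.+_) (⅀-swap f xs ys)) (sym (⅀-+ (f x) (λ y → ⅀ xs (λ x → f x y)) ys))

⅀-↭ : ∀ (f : A → ℚ) {xs ys} → xs ↭ ys → ⅀ xs f ≡ ⅀ ys f
⅀-↭ f ↭.refl           = refl
⅀-↭ f (↭.prep x p)     = cong (f x ℚ.+_) (⅀-↭ f p)
⅀-↭ f {ys = _ ∷ _ ∷ ys} (↭.swap x y p) = begin
  f x ℚ.+ (f y ℚ.+ _)      ≡⟨ cong (λ z → f x ℚ.+ (f y ℚ.+ z)) (⅀-↭ f p) ⟩
  f x ℚ.+ (f y ℚ.+ ⅀ ys f) ≡⟨ ℚ.+-assoc (f x) (f y) (⅀ ys f) ⟨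
  f x ℚ.+ f y ℚ.+ ⅀ ys f   ≡⟨ cong (ℚ._+ ⅀ ys f) (ℚ.+-comm (f x) (f y)) ⟩
  f y ℚ.+ f x ℚ.+ ⅀ ys f   ≡⟨ ℚ.+-assoc (f y) (f x) (⅀ ys f) ⟩
  f y ℚ.+ (f x ℚ.+ ⅀ ys f) ∎
  where open ≡-Reasoning
⅀-↭ f (↭.trans p q)    = trans (⅀-↭ f p) (⅀-↭ f q)

-- Sums over two different enumerations of the same finite set are compared through this.
unique-↭ : {xs ys : List A} → Unique xs → Unique ys →
           (∀ {x} → x ∈ xs → x ∈ ys) → (∀ {x} → x ∈ ys → x ∈ xs) → xs ↭ ys
unique-↭ u v to from = ∼bag⇒↭ (unique∧set⇒bag u v (mk⇔ to from))

concatMap⁺ : ∀ (f : A → List B) {xs x y} → x ∈ xs → y ∈ f x → y ∈ concatMap f xs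
concatMap⁺ f {xs} x∈ y∈ = ∈-concatMap⁺ f {xs = xs} (lose x∈ y∈)

concatMap⁻ : ∀ (f : A → List B) xs {y} → y ∈ concatMap f xs → ∃ λ x → x ∈ xs × y ∈ f x
concatMap⁻ f xs y∈ = find (∈-concatMap⁻ f {xs = xs} y∈)

concatMap-unique : ∀ (f : A → List B) {xs} → Unique xs → (∀ x → Unique (f x)) →
                   (∀ {x x′ y} → x ∈ xs → x′ ∈ xs → y ∈ f x → y ∈ f x′ → x ≡ x′) →
                   Unique (concatMap f xs)
concatMap-unique f []        uf inj = []
concatMap-unique f {x ∷ xs} (x∉ ∷ u) uf inj = Unique.++⁺ (uf _)
  (concatMap-unique f u uf (λ x∈ x′∈ → inj (there x∈) (there x′∈)))
  λ (p , q) → let x′ , x′∈ , q′ = concatMap⁻ f xs q in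
    All.lookup x∉ x′∈ (inj (here refl) (there x′∈) p q′)

⟦_⟧ : {P : Set} → Dec P → ℚ
⟦ yes _ ⟧ = 1ℚ
⟦ no _ ⟧  = 0ℚ

⟦⟧-cong : {P Q : Set} (P? : Dec P) (Q? : Dec Q) → (P → Q) → (Q → P) → ⟦ P? ⟧ ≡ ⟦ Q? ⟧
⟦⟧-cong (yes p) (yes q) to from = refl
⟦⟧-cong (yes p) (no ¬q) to from = contradiction (to p) ¬q
⟦⟧-cong (no ¬p) (yes q) to from = contradiction (from q) ¬p
⟦⟧-cong (no ¬p) (no ¬q) to from = refl

⟦⟧-× : {P Q : Set} (P? : Dec P) (Q? : Dec Q) → ⟦ P? ×-dec Q? ⟧ ≡ ⟦ P? ⟧ ℚ.* ⟦ Q? ⟧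
⟦⟧-× (yes p) (yes q) = refl
⟦⟧-× (yes p) (no ¬q) = refl
⟦⟧-× (no ¬p) Q?      = sym (ℚ.*-zeroˡ ⟦ Q? ⟧)

⅀-filter : ∀ {P : A → Set} (P? : Decidable P) (f : A → ℚ) xs →
           ⅀ (filter P? xs) f ≡ ⅀ xs (λ x → f x ℚ.* ⟦ P? x ⟧)
⅀-filter P? f []       = refl
⅀-filter P? f (x ∷ xs) with P? x
... | yes _ = cong₂ ℚ._+_ (sym (ℚ.*-identityʳ (f x))) (⅀-filter P? f xs)
... | no _  = trans (⅀-filter P? f xs)
  (trans (sym (ℚ.+-identityˡ _)) (cong (ℚ._+ _) (sym (ℚ.*-zeroʳ (f x)))))

⅀-unit : ∀ {xs : List A} (_≟_ : ∀ (x y : A) → Dec (x ≡ y)) {a} → Unique xs → a ∈ xs →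
         ⅀ xs (λ x → ⟦ x ≟ a ⟧) ≡ 1ℚ
⅀-unit _≟_ {a} (a∉ ∷ u) (here refl) with a ≟ a
... | yes _  = cong (1ℚ ℚ.+_) (⅀-zero _ λ {x} x∈ → ne x∈)
  where
  ne : ∀ {x} → x ∈ _ → ⟦ x ≟ a ⟧ ≡ 0ℚ
  ne {x} x∈ with x ≟ a
  ... | yes refl = contradiction refl (All.lookup a∉ x∈)
  ... | no _     = refl
... | no a≢a = contradiction refl a≢a
⅀-unit {xs = y ∷ _} _≟_ {a} (y∉ ∷ u) (there a∈) with y ≟ a
... | yes refl = contradiction refl (All.lookup y∉ a∈)
... | no _     = trans (ℚ.+-identityˡ _) (⅀-unit _≟_ u a∈)

fromℕℚ-suc : ∀ m → fromℕℚ (suc m) ≡ 1ℚ ℚ.+ fromℕℚ m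
fromℕℚ-suc m = ℚ.toℚᵘ-injective (begin
  ℚ.toℚᵘ (fromℕℚ (suc m))                    ≈⟨ ℚ.toℚᵘ-fromℚᵘ (ℚᵘ.mkℚᵘ (+ suc m) 0) ⟩
  ℚᵘ.mkℚᵘ (+ suc m) 0                        ≈⟨ ℚᵘ.*≡* (cong (ℤ._* + 1)
    (cong (ℤ._+_ (+ 1)) (sym (ℤ.*-identityʳ (+ m))))) ⟩
  ℚᵘ.1ℚᵘ ℚᵘ.+ ℚᵘ.mkℚᵘ (+ m) 0
    ≈⟨ ℚᵘ.+-congʳ ℚᵘ.1ℚᵘ (ℚᵘ.≃-sym (ℚ.toℚᵘ-fromℚᵘ (ℚᵘ.mkℚᵘ (+ m) 0))) ⟩
  ℚᵘ.1ℚᵘ ℚᵘ.+ ℚ.toℚᵘ (fromℕℚ m)              ≈⟨ ℚᵘ.≃-sym (ℚ.toℚᵘ-homo-+ 1ℚ (fromℕℚ m)) ⟩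
  ℚ.toℚᵘ (1ℚ ℚ.+ fromℕℚ m)                   ∎)
  where open ℚᵘ.≃-Reasoning

fromℕℚ-nonneg : ∀ m → 0ℚ ℚ.≤ fromℕℚ m
fromℕℚ-nonneg m = ℚ.nonNegative⁻¹ (fromℕℚ m) {{ℚ.normalize-nonNeg m 1}}

fromℕℚ-pos : ∀ m → 0ℚ ℚ.< fromℕℚ (suc m)
fromℕℚ-pos m = ℚ.positive⁻¹ (fromℕℚ (suc m)) {{ℚ.normalize-pos (suc m) 1}}

⅀-const : ∀ c (xs : List A) → ⅀ xs (λ _ → c) ≡ c ℚ.* fromℕℚ (length xs)
⅀-const c []       = sym (ℚ.*-zeroʳ c)
⅀-const c (x ∷ xs) = begin
  c ℚ.+ ⅀ xs (λ _ → c)                  ≡⟨ cong₂ ℚ._+_ (sym (ℚ.*-identityʳ c)) (⅀-const c xs) ⟩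
  c ℚ.* 1ℚ ℚ.+ c ℚ.* fromℕℚ (length xs) ≡⟨ ℚ.*-distribˡ-+ c 1ℚ (fromℕℚ (length xs)) ⟨
  c ℚ.* (1ℚ ℚ.+ fromℕℚ (length xs))     ≡⟨ cong (c ℚ.*_) (fromℕℚ-suc (length xs)) ⟨
  c ℚ.* fromℕℚ (suc (length xs))        ∎
  where open ≡-Reasoning

sgn : ℕ → ℚ
sgn zero    = 1ℚ
sgn (suc n) = ℚ.- sgn n

-- Enumerations of words

∈-words⁺ : ∀ {xs : List A} {m} (v : Vec A m) → All (_∈ xs) (toList v) → v ∈ words xs m
∈-words⁺ Vec.[]      []         = here refl
∈-words⁺ (x Vec.∷ v) (x∈ ∷ v⊆) = ∈-cartesianProductWith⁺ Vec._∷_ x∈ (∈-words⁺ v v⊆)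

∈-words⁻ : ∀ {xs : List A} {m} (v : Vec A m) → v ∈ words xs m → All (_∈ xs) (toList v)
∈-words⁻ Vec.[] _ = []
∈-words⁻ {xs = xs} {m = suc m} (x Vec.∷ v) xv∈
  with _ , _ , x∈ , v∈ , refl ← ∈-cartesianProductWith⁻ Vec._∷_ xs (words xs m) xv∈
  = x∈ ∷ ∈-words⁻ v v∈

words-unique : ∀ {xs : List A} → Unique xs → ∀ m → Unique (words xs m)
words-unique u zero    = [] ∷ []
words-unique u (suc m) =
  Unique.cartesianProductWith⁺ Vec._∷_ Vec.∷-injective u (words-unique u m)

∈-listWords⁺ : ∀ {xs : List A} w → All (_∈ xs) w → w ∈ map toList (words xs (length w))
∈-listWords⁺ {xs = xs} w w⊆ = subst (_∈ map toList (words xs (length w))) (Vec.toList∘fromList w)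
  (∈-map⁺ toList (∈-words⁺ (Vec.fromList w) (subst (All (_∈ xs)) (sym (Vec.toList∘fromList w)) w⊆)))

∈-listWords⁻ : ∀ {xs : List A} {m w} → w ∈ map toList (words xs m) → length w ≡ m × All (_∈ xs) w
∈-listWords⁻ w∈ with v , v∈ , refl ← ∈-map⁻ toList w∈ = Vec.length-toList v , ∈-words⁻ v v∈

toList-inj : ∀ {m} {v w : Vec A m} → toList v ≡ toList w → v ≡ w
toList-inj {v = v} {w} eq = trans (sym (Vec.cast-is-id refl v)) (Vec.toList-injective refl v w eq)

listWords-unique : ∀ {xs : List A} → Unique xs → ∀ m → Unique (map toList (words xs m))
listWords-unique u m = Unique.map⁺ toList-inj (words-unique u m)

-- Packed words

-- The order embedding of ℕ onto the complement of c, and its left inverse.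
shift : ℕ → ℕ → ℕ
shift zero    y       = suc y
shift (suc c) zero    = zero
shift (suc c) (suc y) = suc (shift c y)

unshift : ℕ → ℕ → ℕ
unshift zero    y       = ℕ.pred y
unshift (suc c) zero    = zero
unshift (suc c) (suc y) = suc (unshift c y)

unshift-shift : ∀ c y → unshift c (shift c y) ≡ y
unshift-shift zero    y       = refl
unshift-shift (suc c) zero    = refl
unshift-shift (suc c) (suc y) = cong suc (unshift-shift c y)

shift-unshift : ∀ c y → c ≢ y → shift c (unshift c y) ≡ y
shift-unshift zero    zero    c≢y = contradiction refl c≢y
shift-unshift zero    (suc y) c≢y = refl
shift-unshift (suc c) zero    c≢y = refl
shift-unshift (suc c) (suc y) c≢y = cong suc (shift-unshift c y (c≢y ∘ cong suc))

shift-inj : ∀ c {y z} → shift c y ≡ shift c z → y ≡ z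
shift-inj c {y} {z} eq =
  trans (sym (unshift-shift c y)) (trans (cong (unshift c) eq) (unshift-shift c z))

c≢shift : ∀ c y → c ≢ shift c y
c≢shift (suc c) (suc y) eq = c≢shift c y (ℕ.suc-injective eq)

shift-< : ∀ {c y k} → y ℕ.< k → shift c y ℕ.< suc k
shift-< {zero}          y<k         = ℕ.s<s y<k
shift-< {suc c} {zero}  y<k         = ℕ.z<s
shift-< {suc c} {suc y} (ℕ.s<s y<k) = ℕ.s<s (shift-< y<k)

unshift-< : ∀ {c y k} → c ≢ y → c ℕ.< suc k → y ℕ.< suc k → unshift c y ℕ.< k
unshift-< {zero}  {zero}  c≢y c<k y<k = contradiction refl c≢y
unshift-< {zero}  {suc y} c≢y c<k (ℕ.s<s y<k) = y<k
unshift-< {suc c} {zero}  {suc k} c≢y c<k y<k = ℕ.z<s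
unshift-< {suc c} {zero}  {zero} c≢y (ℕ.s<s ()) y<k
unshift-< {suc c} {suc y} {suc k} c≢y (ℕ.s<s c<k) (ℕ.s<s y<k) =
  ℕ.s<s (unshift-< (c≢y ∘ cong suc) c<k y<k)
unshift-< {suc c} {suc y} {zero} c≢y (ℕ.s<s ()) _

-- Such a word is a surjection from its positions onto the first k letters, or equivalently an
-- ordered partition of the positions into k blocks.
Packed : ℕ → List ℕ → Set
Packed k w = All (ℕ._< k) w × (∀ {c} → c ℕ.< k → c ∈ w)

repeat insert : ∀ {n} → ℕ × Vec ℕ n → ℕ → ℕ × Vec ℕ (suc n)
repeat (k , w) c = k , c Vec.∷ w
insert (k , w) c = suc k , c Vec.∷ Vec.map (shift c) w

-- In terms of ordered set partitions, the new position joins one of the k blocks, or it forms a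
-- block of its own in one of the k + 1 places between, before and after them.
extend : ∀ {n} → ℕ × Vec ℕ n → List (ℕ × Vec ℕ (suc n))
extend (k , w) = map (repeat (k , w)) (upTo k) ++ map (insert (k , w)) (upTo (suc k))

packedWords : ∀ n → List (ℕ × Vec ℕ n)
packedWords zero    = (0 , Vec.[]) ∷ []
packedWords (suc n) = concatMap extend (packedWords n)

packed-shift : ∀ {k c w} → c ℕ.< suc k → Packed k w → Packed (suc k) (c ∷ map (shift c) w)
packed-shift {k} {c} {w} c≤k (w<k , onto) =
  c≤k ∷ All.map⁺ (All.map shift-< w<k) , λ {d} d≤k → case d ℕ.≟ c of λ where
    (yes refl) → here refl
    (no d≢c)   → there (subst (_∈ _) (shift-unshift c d (d≢c ∘ sym))
      (∈-map⁺ (shift c) (onto (unshift-< (d≢c ∘ sym) c≤k d≤k))))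

packed-unshift : ∀ {k c w} → c ∉ w → Packed (suc k) (c ∷ w) → Packed k (map (unshift c) w)
packed-unshift {k} {c} {w} c∉w (c≤k ∷ w≤k , onto) =
  All.map⁺ (All.tabulate λ {y} y∈ → unshift-< (λ { refl → c∉w y∈ }) c≤k (All.lookup w≤k y∈)) ,
  λ {d} d<k → case onto (shift-< {c} d<k) of λ where
    (here eq)  → contradiction (sym eq) (c≢shift c d)
    (there d∈) → subst (_∈ _) (unshift-shift c d) (∈-map⁺ (unshift c) d∈)

map-shift-unshift : ∀ {c n} (w : Vec ℕ n) → c ∉ toList w →
                    Vec.map (shift c) (Vec.map (unshift c) w) ≡ w
map-shift-unshift Vec.[]      c∉ = refl
map-shift-unshift (y Vec.∷ w) c∉ =
  cong₂ Vec._∷_ (shift-unshift _ y (c∉ ∘ here)) (map-shift-unshift w (c∉ ∘ there))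

∈-packedWords⁺ : ∀ {n k} (w : Vec ℕ n) → Packed k (toList w) → (k , w) ∈ packedWords n
∈-packedWords⁺ {k = zero}  Vec.[] p = here refl
∈-packedWords⁺ {k = suc k} Vec.[] (_ , onto) with () ← onto {0} ℕ.z<s
∈-packedWords⁺ {suc n} {k} (c Vec.∷ w) p@(c<k ∷ w<k , onto) with c ∈? toList w
... | yes c∈ = concatMap⁺ extend
  (∈-packedWords⁺ w (w<k , λ d<k → case onto d<k of λ where
    (here refl) → c∈
    (there d∈)  → d∈))
  (∈-++⁺ˡ (∈-map⁺ (repeat (k , w)) (∈-upTo⁺ c<k)))
∈-packedWords⁺ {suc n} {suc k} (c Vec.∷ w) p@(c<k ∷ w<k , onto) | no c∉ =
  concatMap⁺ extend
    (∈-packedWords⁺ (Vec.map (unshift c) w)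
      (subst (Packed k) (sym (Vec.toList-map (unshift c) w)) (packed-unshift c∉ p)))
    (∈-++⁺ʳ (map (repeat (k , Vec.map (unshift c) w)) (upTo k))
      (subst (λ v → (suc k , c Vec.∷ v) ∈ map (insert (k , Vec.map (unshift c) w)) (upTo (suc k)))
        (map-shift-unshift w c∉)
        (∈-map⁺ (insert (k , Vec.map (unshift c) w)) (∈-upTo⁺ c<k))))

∈-packedWords⁻ : ∀ {n k} (w : Vec ℕ n) → (k , w) ∈ packedWords n → Packed k (toList w)
∈-packedWords⁻ {zero} Vec.[] (here refl) = [] , λ ()
∈-packedWords⁻ {suc n} w kw∈
  with (k , w′) , kw′∈ , ext∈ ← concatMap⁻ extend (packedWords n) kw∈
  with ∈-++⁻ (map (repeat (k , w′)) (upTo k)) ext∈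
... | inj₁ p with c , c∈ , refl ← ∈-map⁻ _ p
  = let w<k , onto = ∈-packedWords⁻ w′ kw′∈ in ∈-upTo⁻ c∈ ∷ w<k , there ∘ onto
... | inj₂ p with c , c∈ , refl ← ∈-map⁻ _ p
  = subst (λ v → Packed (suc k) (c ∷ v)) (sym (Vec.toList-map (shift c) w′))
      (packed-shift (∈-upTo⁻ c∈) (∈-packedWords⁻ w′ kw′∈))

map-inj : ∀ {f : A → B} → (∀ {x y} → f x ≡ f y → x ≡ y) →
          ∀ {n} {v w : Vec A n} → Vec.map f v ≡ Vec.map f w → v ≡ w
map-inj inj {v = Vec.[]}    {Vec.[]}    eq = refl
map-inj inj {v = x Vec.∷ v} {y Vec.∷ w} eq =
  cong₂ Vec._∷_ (inj (Vec.∷-injectiveˡ eq)) (map-inj inj (Vec.∷-injectiveʳ eq))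

∉-shift : ∀ {n c} (w : Vec ℕ n) → c ∉ toList (Vec.map (shift c) w)
∉-shift {c = c} w c∈ with y , _ , eq ← ∈-map⁻ (shift c) (subst (c ∈_) (Vec.toList-map (shift c) w) c∈)
  = c≢shift c y eq

,-injʳ : ∀ {k} {x y : A} → _≡_ {A = ℕ × A} (k , x) (k , y) → x ≡ y
,-injʳ refl = refl

packedWords-unique : ∀ n → Unique (packedWords n)
packedWords-unique zero    = [] ∷ []
packedWords-unique (suc n) = concatMap-unique extend (packedWords-unique n)
  (λ (k , w) → Unique.++⁺
    (Unique.map⁺ (λ eq → Vec.∷-injectiveˡ (,-injʳ eq)) (Unique.upTo⁺ k))
    (Unique.map⁺ (λ eq → Vec.∷-injectiveˡ (,-injʳ eq)) (Unique.upTo⁺ (suc k)))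
    λ (p , q) → case ∈-map⁻ _ p , ∈-map⁻ _ q of λ { ((_ , _ , refl) , (_ , _ , ())) })
  disjoint
  where
  -- The tail tells the two kinds of extension apart: the first letter of a `repeat` occurs in it,
  -- because the shorter word is packed, and the first letter of an `insert` does not.
  disjoint : ∀ {x x′ y} → x ∈ packedWords n → x′ ∈ packedWords n →
             y ∈ extend x → y ∈ extend x′ → x ≡ x′
  disjoint {k , w} {k′ , w′} x∈ x′∈ p q
    with ∈-++⁻ (map (repeat (k , w)) (upTo k)) p | ∈-++⁻ (map (repeat (k′ , w′)) (upTo k′)) q
  ... | inj₁ p | inj₁ q with _ , _ , refl ← ∈-map⁻ _ p | _ , _ , refl ← ∈-map⁻ _ q = refl
  ... | inj₁ p | inj₂ q with _ , c∈ , refl ← ∈-map⁻ _ p | _ , _ , refl ← ∈-map⁻ _ q =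
    contradiction (proj₂ (∈-packedWords⁻ w x∈) (∈-upTo⁻ c∈)) (∉-shift w′)
  ... | inj₂ p | inj₁ q with _ , _ , refl ← ∈-map⁻ _ p | _ , c∈ , refl ← ∈-map⁻ _ q =
    contradiction (proj₂ (∈-packedWords⁻ w′ x′∈) (∈-upTo⁻ c∈)) (∉-shift w)
  ... | inj₂ p | inj₂ q with c , _ , refl ← ∈-map⁻ _ p | _ , _ , eq ← ∈-map⁻ _ q
    with refl ← cong proj₁ eq
    with refl ← Vec.∷-injectiveˡ (,-injʳ eq) =
    cong (_ ,_) (map-inj (shift-inj c) (Vec.∷-injectiveʳ (,-injʳ eq)))

packedWords-≤ : ∀ {n k} (w : Vec ℕ n) → (k , w) ∈ packedWords n → k ℕ.≤ n
packedWords-≤ {zero} w (here refl) = ℕ.z≤n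
packedWords-≤ {suc n} w kw∈
  with (k , w′) , kw′∈ , ext∈ ← concatMap⁻ extend (packedWords n) kw∈
  with ∈-++⁻ (map (repeat (k , w′)) (upTo k)) ext∈
... | inj₁ p with _ , _ , refl ← ∈-map⁻ _ p = ℕ.m≤n⇒m≤1+n (packedWords-≤ w′ kw′∈)
... | inj₂ p with _ , _ , refl ← ∈-map⁻ _ p = ℕ.s≤s (packedWords-≤ w′ kw′∈)

-- A pigeonhole principle, read off from the enumeration: each step of `extend` adds one position
-- and at most one letter.
packed-≤ : ∀ {k} w → Packed k w → k ℕ.≤ length w
packed-≤ w p = packedWords-≤ (Vec.fromList w)
  (∈-packedWords⁺ (Vec.fromList w) (subst (Packed _) (sym (Vec.toList∘fromList w)) p))

-- Contents, compositions and the functional Φ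

occ : ℕ → List ℕ → ℕ
occ c w = length (filter (c ℕ.≟_) w)

content : ℕ → List ℕ → List ℕ
content k w = map (λ c → occ c w) (upTo k)

length-content : ∀ k w → length (content k w) ≡ k
length-content k w = trans (List.length-map _ (upTo k)) (List.length-upTo k)

filter-pos : ∀ {P : A → Set} (P? : Decidable P) {x xs} → x ∈ xs → P x → 1 ℕ.≤ length (filter P? xs)
filter-pos P? {xs = xs} x∈ px with filter P? xs | ∈-filter⁺ P? x∈ px
... | _ ∷ _ | _ = ℕ.s≤s ℕ.z≤n

filter-pos⁻ : ∀ {P : A → Set} (P? : Decidable P) xs → 1 ℕ.≤ length (filter P? xs) →
              ∃ λ x → x ∈ xs × P x
filter-pos⁻ P? xs pos with filter P? xs in eq
... | y ∷ _ = y , ∈-filter⁻ P? (subst (y ∈_) (sym eq) (here refl))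

occ-pos : ∀ {c w} → c ∈ w → 1 ℕ.≤ occ c w
occ-pos c∈ = filter-pos (_ ℕ.≟_) c∈ refl

occ-pos⁻ : ∀ {c w} → 1 ℕ.≤ occ c w → c ∈ w
occ-pos⁻ {c} {w} pos with _ , c∈ , refl ← filter-pos⁻ (c ℕ.≟_) w pos = c∈

compositionsOfLength : ℕ → ℕ → List (List ℕ)
compositionsOfLength n ℓ = map toList (words (map suc (upTo n)) ℓ)

-- A list containing the compositions of n, the same one from which `partitions` selects.
compositions : ℕ → List (List ℕ)
compositions n = concatMap (compositionsOfLength n) (upTo (suc n))

compositions-unique : ∀ n → Unique (compositions n)
compositions-unique n = concatMap-unique (compositionsOfLength n) (Unique.upTo⁺ (suc n))
  (listWords-unique (Unique.map⁺ ℕ.suc-injective (Unique.upTo⁺ n)))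
  λ _ _ p q → trans (sym (proj₁ (∈-listWords⁻ p))) (proj₁ (∈-listWords⁻ q))

∈-compositions⁺ : ∀ {n} α → length α ℕ.≤ n → All (λ a → 1 ℕ.≤ a × a ℕ.≤ n) α → α ∈ compositions n
∈-compositions⁺ {n} α ℓ≤n bounds = concatMap⁺ (compositionsOfLength n) (∈-upTo⁺ (ℕ.s≤s ℓ≤n))
  (∈-listWords⁺ α (All.map (λ { {suc a} (_ , a<n) → ∈-map⁺ suc (∈-upTo⁺ a<n) }) bounds))

∈-compositions⁻ : ∀ {n} α → α ∈ compositions n → All (1 ℕ.≤_) α
∈-compositions⁻ {n} α α∈ with _ , _ , α∈ ← concatMap⁻ (compositionsOfLength n) (upTo (suc n)) α∈ =
  All.map (λ a∈ → case ∈-map⁻ suc a∈ of λ { (_ , _ , refl) → ℕ.s≤s ℕ.z≤n })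
    (proj₂ (∈-listWords⁻ α∈))

-- The functional extracting [s_(1ⁿ)], read off from eₙ = ∑_α (-1)^(n-ℓ(α)) h_α, the sum being
-- over compositions α of n.  Lists α with a sum other than n do no harm, as F has degree n.
Φ : ℕ → Series → ℚ
Φ n F = ⅀ (compositions n) (λ α → sgn (n ℕ.+ length α) ℚ.* F α)

-- Common ground for X, with colourings as objects, and s, with tableaux as objects. The double sum
-- in Φ, over α and over the objects of content α, becomes a single sum over the objects whose word
-- is packed: all parts of α are positive, so each letter below `length α` occurs. Conversely α is
-- the content of the word, which makes the blocks disjoint.
module GeneratingFunction
  {O : Set} (objects : ℕ → List O) (word : O → List ℕ) {P : O → Set} (P? : Decidable P) (n : ℕ)
  (objects-unique : ∀ k → Unique (objects k))
  (objects⁻ : ∀ {k o} → o ∈ objects k → All (ℕ._< k) (word o) × length (word o) ≡ n) where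

  series : Series
  series α = count (λ o → P? o ×-dec hasMonomial? α (word o)) (objects (length α))

  block : List ℕ → List (ℕ × O)
  block α = map (length α ,_)
    (filter (λ o → P? o ×-dec hasMonomial? α (word o)) (objects (length α)))

  packedObjects : List (ℕ × O)
  packedObjects = concatMap block (compositions n)

  block⁻ : ∀ {α k o} → (k , o) ∈ block α →
           k ≡ length α × o ∈ objects k × P o × HasMonomial α (word o)
  block⁻ {α} ko∈ with o , o∈ , refl ← ∈-map⁻ (length α ,_) ko∈ =
    refl , ∈-filter⁻ _ {xs = objects (length α)} o∈

  packedObjects-unique : Unique packedObjects
  packedObjects-unique = concatMap-unique block (compositions-unique n)
    (λ α → Unique.map⁺ ,-injʳ (Unique.filter⁺ _ (objects-unique (length α))))
    λ {α} {β} {ko} _ _ p q → case block⁻ {α} p , block⁻ {β} q of λ where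
      ((ℓα , _ , _ , eqα) , (ℓβ , _ , _ , eqβ)) → trans (sym eqα)
        (trans (cong (λ k → content k (word (proj₂ ko))) (trans (sym ℓα) ℓβ)) eqβ)

  ∈-packedObjects⁻ : ∀ {k o} → (k , o) ∈ packedObjects → o ∈ objects k × P o × Packed k (word o)
  ∈-packedObjects⁻ {k} {o} ko∈
    with α , α∈ , p ← concatMap⁻ block (compositions n) ko∈
    with refl , o∈ , po , eq ← block⁻ {α} p
    = o∈ , po , proj₁ (objects⁻ o∈) , λ {c} c<k → occ-pos⁻ {c} (All.lookup
        (∈-compositions⁻ {n} α α∈) (subst (occ c (word o) ∈_) eq (∈-map⁺ _ (∈-upTo⁺ c<k))))

  ∈-packedObjects⁺ : ∀ {k o} → o ∈ objects k → P o → Packed k (word o) → (k , o) ∈ packedObjects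
  ∈-packedObjects⁺ {k} {o} o∈ po p@(_ , onto) = concatMap⁺ block
    (∈-compositions⁺ α (subst₂ ℕ._≤_ (sym ℓα) |w| (packed-≤ (word o) p))
      (All.map⁺ (All.map (λ c<k → occ-pos (onto c<k) ,
        subst (occ _ (word o) ℕ.≤_) |w| (List.length-filter _ (word o))) (All.all-upTo k))))
    (subst (λ k → (k , o) ∈ block α) ℓα (∈-map⁺ (length α ,_) (∈-filter⁺ _
      (subst (λ k → o ∈ objects k) (sym ℓα) o∈)
      (po , cong (λ k → content k (word o)) ℓα))))
    where
    α = content k (word o)
    ℓα = length-content k (word o)
    |w| = proj₂ (objects⁻ o∈)

  Φ-series : Φ n series ≡ ⅀ packedObjects (λ ko → sgn (n ℕ.+ proj₁ ko))
  Φ-series = sym (trans (⅀-concatMap _ block (compositions n)) (⅀-cong (compositions n) λ {α} _ →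
    trans (⅀-map _ (length α ,_) (filter _ (objects (length α))))
      (⅀-const (sgn (n ℕ.+ length α)) (filter _ (objects (length α))))))

-- The deletion recursion for signed counts of proper colourings

⅀-packedWords-suc : ∀ {n} (f : ℕ × Vec ℕ (suc n) → ℚ) → ⅀ (packedWords (suc n)) f ≡
  ⅀ (packedWords n) (λ kw → ⅀ (upTo (proj₁ kw)) (f ∘ repeat kw) ℚ.+
                            ⅀ (upTo (suc (proj₁ kw))) (f ∘ insert kw))
⅀-packedWords-suc {n} f = trans (⅀-concatMap f extend (packedWords n))
  (⅀-cong (packedWords n) λ {kw@(k , w)} _ →
    trans (⅀-++ f (map (repeat kw) (upTo k)) (map (insert kw) (upTo (suc k))))
      (cong₂ ℚ._+_ (⅀-map f (repeat kw) (upTo k)) (⅀-map f (insert kw) (upTo (suc k)))))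

-- Each distinct letter is counted at its last occurrence.
distinct : List ℕ → ℚ
distinct []      = 0ℚ
distinct (x ∷ w) = ⟦ ¬? (x ∈? w) ⟧ ℚ.+ distinct w

-- Prepending `x` changes the set of missing letters at `x` only, and there only if `x` was missing
-- before.
∉-∷-indicator : ∀ c x w → ⟦ ¬? (c ∈? (x ∷ w)) ⟧ ℚ.+ ⟦ ¬? (x ∈? w) ⟧ ℚ.* ⟦ c ℕ.≟ x ⟧ ≡ ⟦ ¬? (c ∈? w) ⟧
∉-∷-indicator c x w = case c ℕ.≟ x of λ where
    (yes refl) → trans (cong₂ (λ p q → p ℚ.+ ⟦ ¬? (c ∈? w) ⟧ ℚ.* q)
        (⟦⟧-false (¬? (c ∈? (x ∷ w))) (λ c∉ → c∉ (here refl))) (⟦⟧-true (c ℕ.≟ x) refl))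
      (trans (ℚ.+-identityˡ _) (ℚ.*-identityʳ _))
    (no c≢x) → trans (cong₂ (λ p q → p ℚ.+ ⟦ ¬? (x ∈? w) ⟧ ℚ.* q)
        (⟦⟧-cong (¬? (c ∈? (x ∷ w))) (¬? (c ∈? w)) (_∘ there)
          (λ { c∉ (here eq) → c≢x eq ; c∉ (there c∈) → c∉ c∈ })) (⟦⟧-false (c ℕ.≟ x) c≢x))
      (trans (cong (⟦ ¬? (c ∈? w) ⟧ ℚ.+_) (ℚ.*-zeroʳ ⟦ ¬? (x ∈? w) ⟧))
        (ℚ.+-identityʳ ⟦ ¬? (c ∈? w) ⟧))
  where
  ⟦⟧-true : {P : Set} (P? : Dec P) → P → ⟦ P? ⟧ ≡ 1ℚ
  ⟦⟧-true (yes _) p = refl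
  ⟦⟧-true (no ¬p) p = contradiction p ¬p

  ⟦⟧-false : {P : Set} (P? : Dec P) → ¬ P → ⟦ P? ⟧ ≡ 0ℚ
  ⟦⟧-false (yes p) ¬p = contradiction p ¬p
  ⟦⟧-false (no _)  ¬p = refl

-- Summing `∉-∷-indicator` over the alphabet shows that a letter seen for the first time moves one
-- unit from the first summand to the second.
missing+distinct : ∀ {k} w → All (ℕ._< k) w →
                   ⅀ (upTo k) (λ c → ⟦ ¬? (c ∈? w) ⟧) ℚ.+ distinct w ≡ fromℕℚ k
missing+distinct {k} [] [] = begin
  ⅀ (upTo k) (λ _ → 1ℚ) ℚ.+ 0ℚ ≡⟨ ℚ.+-identityʳ _ ⟩
  ⅀ (upTo k) (λ _ → 1ℚ)        ≡⟨ ⅀-const 1ℚ (upTo k) ⟩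
  1ℚ ℚ.* fromℕℚ (length (upTo k)) ≡⟨ ℚ.*-identityˡ _ ⟩
  fromℕℚ (length (upTo k))     ≡⟨ cong fromℕℚ (List.length-upTo k) ⟩
  fromℕℚ k                     ∎
  where open ≡-Reasoning
missing+distinct {k} (x ∷ w) (x<k ∷ w<k) = begin
  ⅀ (upTo k) m′ ℚ.+ (new ℚ.+ distinct w)      ≡⟨ ℚ.+-assoc (⅀ (upTo k) m′) new (distinct w) ⟨
  ⅀ (upTo k) m′ ℚ.+ new ℚ.+ distinct w        ≡⟨ cong (λ z → ⅀ (upTo k) m′ ℚ.+ z ℚ.+ distinct w) new-eq ⟩
  ⅀ (upTo k) m′ ℚ.+ ⅀ (upTo k) e ℚ.+ distinct w ≡⟨ cong (ℚ._+ distinct w) (⅀-+ m′ e (upTo k)) ⟨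
  ⅀ (upTo k) (λ c → m′ c ℚ.+ e c) ℚ.+ distinct w
    ≡⟨ cong (ℚ._+ distinct w) (⅀-cong (upTo k) (λ {c} _ → ∉-∷-indicator c x w)) ⟩
  ⅀ (upTo k) (λ c → ⟦ ¬? (c ∈? w) ⟧) ℚ.+ distinct w ≡⟨ missing+distinct w w<k ⟩
  fromℕℚ k ∎
  where
  open ≡-Reasoning
  new = ⟦ ¬? (x ∈? w) ⟧
  m′ e : ℕ → ℚ
  m′ c = ⟦ ¬? (c ∈? (x ∷ w)) ⟧
  e c = new ℚ.* ⟦ c ℕ.≟ x ⟧

  new-eq : new ≡ ⅀ (upTo k) e
  new-eq = sym (trans (⅀-*ˡ new (λ c → ⟦ c ℕ.≟ x ⟧) (upTo k))
    (trans (cong (new ℚ.*_) (⅀-unit ℕ._≟_ (Unique.upTo⁺ k) (∈-upTo⁺ x<k))) (ℚ.*-identityʳ new)))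

deleteZero : ∀ {n} → Graph (suc n) → Graph n
deleteZero G = record
  { Adj    = λ u v → Adj G (suc u) (suc v)
  ; adj?   = λ u v → adj? G (suc u) (suc v)
  ; symm   = symm G
  ; irrefl = λ { refl → irrefl G refl }
  }

neighboursOfZero : ∀ {n} → Graph (suc n) → List (Fin n)
neighboursOfZero {n} G = filter (λ u → adj? G zero (suc u)) (allFin n)

addStar : ∀ {n} → Graph n → (u : Fin n) (us : List (Fin n)) → All (u ≢_) us → Graph n
addStar {n} G u us u∉ = record
  { Adj    = λ v w → Adj G v w ⊎ (v ≡ u × w ∈ us) ⊎ (w ≡ u × v ∈ us)
  ; adj?   = λ v w → adj? G v w ⊎-dec
               ((v Fin.≟ u) ×-dec (w ∈ᶠ? us)) ⊎-dec ((w Fin.≟ u) ×-dec (v ∈ᶠ? us))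
  ; symm   = λ { (inj₁ a) → inj₁ (symm G a)
               ; (inj₂ (inj₁ p)) → inj₂ (inj₂ p) ; (inj₂ (inj₂ p)) → inj₂ (inj₁ p) }
  ; irrefl = λ { refl (inj₁ a) → irrefl G refl a
               ; refl (inj₂ (inj₁ (refl , w∈))) → All.lookup u∉ w∈ refl
               ; refl (inj₂ (inj₂ (refl , w∈))) → All.lookup u∉ w∈ refl }
  }
  where
  open import Data.List.Membership.DecPropositional (Fin._≟_ {n}) using ()
    renaming (_∈?_ to _∈ᶠ?_)

∈-map-lookup : ∀ {n c} {us : List (Fin n)} (w : Vec ℕ n) {v} → v ∈ us → c ≡ lookup w v →
               c ∈ map (lookup w) us
∈-map-lookup w v∈ refl = ∈-map⁺ (lookup w) v∈

proper-repeat : ∀ {n} (G : Graph (suc n)) c (w : Vec ℕ n) → ⟦ proper? G (c Vec.∷ w) ⟧ ≡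
  ⟦ proper? (deleteZero G) w ⟧ ℚ.* ⟦ ¬? (c ∈? map (lookup w) (neighboursOfZero G)) ⟧
proper-repeat G c w = trans
  (⟦⟧-cong (proper? G (c Vec.∷ w))
    (proper? (deleteZero G) w ×-dec ¬? (c ∈? map (lookup w) (neighboursOfZero G))) to from)
  (⟦⟧-× (proper? (deleteZero G) w) (¬? (c ∈? map (lookup w) (neighboursOfZero G))))
  where
  to : Proper G (c Vec.∷ w) → Proper (deleteZero G) w × c ∉ map (lookup w) (neighboursOfZero G)
  to p = (λ u v → p (suc u) (suc v)) , λ c∈ → case ∈-map⁻ (lookup w) c∈ of λ where
    (u , u∈ , eq) → p zero (suc u) (proj₂ (∈-filter⁻ _ {xs = allFin _} u∈)) eq

  from : Proper (deleteZero G) w × c ∉ map (lookup w) (neighboursOfZero G) → Proper G (c Vec.∷ w)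
  from (p , c∉) zero    zero    a _  = irrefl G refl a
  from (p , c∉) zero    (suc v) a eq =
    c∉ (∈-map-lookup w (∈-filter⁺ _ (∈-allFin v) a) eq)
  from (p , c∉) (suc u) zero    a eq =
    c∉ (∈-map-lookup w (∈-filter⁺ _ (∈-allFin u) (symm G a)) (sym eq))
  from (p , c∉) (suc u) (suc v) a eq = p u v a eq

proper-insert : ∀ {n} (G : Graph (suc n)) c (w : Vec ℕ n) →
  ⟦ proper? G (c Vec.∷ Vec.map (shift c) w) ⟧ ≡ ⟦ proper? (deleteZero G) w ⟧
proper-insert G c w =
  ⟦⟧-cong (proper? G (c Vec.∷ Vec.map (shift c) w)) (proper? (deleteZero G) w) to from
  where
  look : ∀ u → lookup (Vec.map (shift c) w) u ≡ shift c (lookup w u)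
  look u = Vec.lookup-map u (shift c) w

  to : Proper G (c Vec.∷ Vec.map (shift c) w) → Proper (deleteZero G) w
  to p u v a eq = p (suc u) (suc v) a (trans (look u) (trans (cong (shift c) eq) (sym (look v))))

  from : Proper (deleteZero G) w → Proper G (c Vec.∷ Vec.map (shift c) w)
  from p zero    zero    a _  = irrefl G refl a
  from p zero    (suc v) a eq = c≢shift c (lookup w v) (trans eq (look v))
  from p (suc u) zero    a eq = c≢shift c (lookup w u) (trans (sym eq) (look u))
  from p (suc u) (suc v) a eq = p u v a (shift-inj c (trans (sym (look u)) (trans eq (look v))))

-- The second factor is the summand of `distinct` that belongs to `u`. Expressed as properness for
-- another graph, it turns a weighted count of colourings into unweighted ones.
proper-addStar : ∀ {n} (G : Graph n) u us (u∉ : All (u ≢_) us) (w : Vec ℕ n) →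
  ⟦ proper? (addStar G u us u∉) w ⟧ ≡
  ⟦ proper? G w ⟧ ℚ.* ⟦ ¬? (lookup w u ∈? map (lookup w) us) ⟧
proper-addStar G u us u∉ w = trans
  (⟦⟧-cong (proper? (addStar G u us u∉) w)
    (proper? G w ×-dec ¬? (lookup w u ∈? map (lookup w) us)) to from)
  (⟦⟧-× (proper? G w) (¬? (lookup w u ∈? map (lookup w) us)))
  where
  to : Proper (addStar G u us u∉) w → Proper G w × lookup w u ∉ map (lookup w) us
  to p = (λ v v′ → p v v′ ∘ inj₁) , λ c∈ → case ∈-map⁻ (lookup w) c∈ of λ where
    (v , v∈ , eq) → p u v (inj₂ (inj₁ (refl , v∈))) eq

  from : Proper G w × lookup w u ∉ map (lookup w) us → Proper (addStar G u us u∉) w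
  from (p , c∉) v v′ (inj₁ a) eq = p v v′ a eq
  from (p , c∉) v v′ (inj₂ (inj₁ (refl , v∈))) eq = c∉ (∈-map-lookup w v∈ eq)
  from (p , c∉) v v′ (inj₂ (inj₂ (refl , v∈))) eq = c∉ (∈-map-lookup w v∈ (sym eq))

∈-toList : ∀ {n} (u : Fin n) (w : Vec A n) → lookup w u ∈ toList w
∈-toList zero    (_ Vec.∷ _) = here refl
∈-toList (suc u) (_ Vec.∷ w) = there (∈-toList u w)

-- If aₖ proper colourings use exactly the first k letters, the chromatic polynomial is χ(q) = ∑ₖ aₖ
-- C(q,k). As C(-1,k) = (-1)^k, this sum is (-1)^n χ(-1), which by Stanley's theorem is the number
-- of acyclic orientations.
signedCount : ∀ {n} → Graph n → ℚ
signedCount {n} G = ⅀ (packedWords n) (λ (k , w) → sgn (n ℕ.+ k) ℚ.* ⟦ proper? G w ⟧)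

module _ {n : ℕ} (G : Graph n) where

  signedDistinct : List (Fin n) → ℚ
  signedDistinct us = ⅀ (packedWords n)
    (λ (k , w) → sgn (n ℕ.+ k) ℚ.* ⟦ proper? G w ⟧ ℚ.* distinct (map (lookup w) us))

  signedDistinct-∷ : ∀ u us (u∉ : All (u ≢_) us) →
    signedDistinct (u ∷ us) ≡ signedCount (addStar G u us u∉) ℚ.+ signedDistinct us
  signedDistinct-∷ u us u∉ = trans
    (⅀-cong (packedWords n) λ {(k , w)} _ → let s = sgn (n ℕ.+ k) ; p = ⟦ proper? G w ⟧ in
      trans (ℚ.*-distribˡ-+ (s ℚ.* p) ⟦ ¬? (lookup w u ∈? map (lookup w) us) ⟧ _)
        (cong (ℚ._+ _) (trans (ℚ.*-assoc s p _) (cong (s ℚ.*_) (sym (proper-addStar G u us u∉ w))))))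
    (⅀-+ _ _ (packedWords n))

  -- The induction hypothesis `pos` ranges over all graphs on n vertices, since each neighbour
  -- brings in a different graph `addStar`.
  signedDistinct-nonneg : (∀ H → 0ℚ ℚ.< signedCount {n} H) → ∀ {us} → Unique us →
                          0ℚ ℚ.≤ signedDistinct us
  signedDistinct-nonneg pos {[]}     [] = ⅀-nonneg (packedWords n)
    λ {(k , w)} _ → ℚ.≤-reflexive (sym (ℚ.*-zeroʳ (sgn (n ℕ.+ k) ℚ.* ⟦ proper? G w ⟧)))
  signedDistinct-nonneg pos {u ∷ us} (u∉ ∷ uniq) = subst (0ℚ ℚ.≤_)
    (sym (signedDistinct-∷ u us u∉))
    (ℚ.+-mono-≤ (ℚ.<⇒≤ (pos (addStar G u us u∉))) (signedDistinct-nonneg pos uniq))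

-- A packed word w on k letters extends in k + 1 ways by a new first letter, and in k - d ways by
-- an old one, where d is the number of letters on the neighbours of the first vertex; the latter
-- extensions have the opposite sign.
signedCount-suc : ∀ {n} (G : Graph (suc n)) → signedCount G ≡
  signedCount (deleteZero G) ℚ.+ signedDistinct (deleteZero G) (neighboursOfZero G)
signedCount-suc {n} G = trans
  (⅀-packedWords-suc (λ kw → sgn (suc n ℕ.+ proj₁ kw) ℚ.* ⟦ proper? G (proj₂ kw) ⟧))
  (trans (⅀-cong (packedWords n) step) (⅀-+ _ _ (packedWords n)))
  where
  open ≡-Reasoning
  step : ∀ {kw} → kw ∈ packedWords n →
    ⅀ (upTo (proj₁ kw)) (λ c → sgn (suc n ℕ.+ proj₁ kw) ℚ.* ⟦ proper? G (c Vec.∷ proj₂ kw) ⟧) ℚ.+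
    ⅀ (upTo (suc (proj₁ kw))) (λ c → sgn (suc n ℕ.+ suc (proj₁ kw)) ℚ.*
      ⟦ proper? G (c Vec.∷ Vec.map (shift c) (proj₂ kw)) ⟧) ≡
    sgn (n ℕ.+ proj₁ kw) ℚ.* ⟦ proper? (deleteZero G) (proj₂ kw) ⟧ ℚ.+
    sgn (n ℕ.+ proj₁ kw) ℚ.* ⟦ proper? (deleteZero G) (proj₂ kw) ⟧ ℚ.*
      distinct (map (lookup (proj₂ kw)) (neighboursOfZero G))
  step {k , w} kw∈ = begin
    _ ≡⟨ cong₂ ℚ._+_ repeated inserted ⟩
    ℚ.- σ ℚ.* p ℚ.* m ℚ.+ ℚ.- (ℚ.- σ) ℚ.* p ℚ.* (1ℚ ℚ.+ fromℕℚ k)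
      ≡⟨ cong (λ z → ℚ.- σ ℚ.* p ℚ.* m ℚ.+ ℚ.- (ℚ.- σ) ℚ.* p ℚ.* (1ℚ ℚ.+ z))
           (sym (missing+distinct L L<k)) ⟩
    ℚ.- σ ℚ.* p ℚ.* m ℚ.+ ℚ.- (ℚ.- σ) ℚ.* p ℚ.* (1ℚ ℚ.+ (m ℚ.+ d))
      ≡⟨ solve 4 (λ σ p m d → :- σ :* p :* m :+ :- (:- σ) :* p :* (con 1ℚ :+ (m :+ d)) :=
           σ :* p :+ σ :* p :* d) refl σ p m d ⟩
    σ ℚ.* p ℚ.+ σ ℚ.* p ℚ.* d ∎
    where
    open +-*-Solver hiding (⟦_⟧)
    L = map (lookup w) (neighboursOfZero G)
    σ = sgn (n ℕ.+ k)
    p = ⟦ proper? (deleteZero G) w ⟧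
    m = ⅀ (upTo k) (λ c → ⟦ ¬? (c ∈? L) ⟧)
    d = distinct L

    L<k : All (ℕ._< k) L
    L<k = All.map⁺ (All.tabulate λ {u} _ →
      All.lookup (proj₁ (∈-packedWords⁻ w kw∈)) (∈-toList u w))

    repeated : ⅀ (upTo k) (λ c → ℚ.- σ ℚ.* ⟦ proper? G (c Vec.∷ w) ⟧) ≡ ℚ.- σ ℚ.* p ℚ.* m
    repeated = trans
      (⅀-cong (upTo k) λ {c} _ → trans (cong (ℚ.- σ ℚ.*_) (proper-repeat G c w))
        (sym (ℚ.*-assoc (ℚ.- σ) p ⟦ ¬? (c ∈? L) ⟧)))
      (⅀-*ˡ (ℚ.- σ ℚ.* p) (λ c → ⟦ ¬? (c ∈? L) ⟧) (upTo k))

    inserted : ⅀ (upTo (suc k)) (λ c → sgn (suc n ℕ.+ suc k) ℚ.*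
                 ⟦ proper? G (c Vec.∷ Vec.map (shift c) w) ⟧) ≡
               ℚ.- (ℚ.- σ) ℚ.* p ℚ.* (1ℚ ℚ.+ fromℕℚ k)
    inserted = begin
      _ ≡⟨ ⅀-cong (upTo (suc k)) (λ {c} _ → cong₂ (λ j q → sgn (suc j) ℚ.* q)
             (ℕ.+-suc n k) (proper-insert G c w)) ⟩
      ⅀ (upTo (suc k)) (λ _ → ℚ.- (ℚ.- σ) ℚ.* p)
        ≡⟨ ⅀-const (ℚ.- (ℚ.- σ) ℚ.* p) (upTo (suc k)) ⟩
      ℚ.- (ℚ.- σ) ℚ.* p ℚ.* fromℕℚ (length (upTo (suc k)))
        ≡⟨ cong (ℚ.- (ℚ.- σ) ℚ.* p ℚ.*_)
             (trans (cong fromℕℚ (List.length-upTo (suc k))) (fromℕℚ-suc k)) ⟩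
      ℚ.- (ℚ.- σ) ℚ.* p ℚ.* (1ℚ ℚ.+ fromℕℚ k) ∎

-- The induction runs over all graphs, as deleting a vertex may disconnect. It starts at the empty
-- graph, whose empty colouring counts 1.
signedCount-positive : ∀ {n} (G : Graph n) → 0ℚ ℚ.< signedCount G
signedCount-positive {zero} G = ℚ.positive⁻¹ 1ℚ
signedCount-positive {suc n} G = subst (0ℚ ℚ.<_) (sym (signedCount-suc G))
  (ℚ.+-mono-<-≤ (signedCount-positive (deleteZero G))
    (signedDistinct-nonneg (deleteZero G) signedCount-positive
      (Unique.filter⁺ _ (Unique.allFin⁺ n))))

∈-words-upTo⁺ : ∀ {n k} (w : Vec ℕ n) → All (ℕ._< k) (toList w) → w ∈ words (upTo k) n
∈-words-upTo⁺ w w<k = ∈-words⁺ w (All.map ∈-upTo⁺ w<k)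

∈-words-upTo⁻ : ∀ {n k} (w : Vec ℕ n) → w ∈ words (upTo k) n → All (ℕ._< k) (toList w)
∈-words-upTo⁻ w w∈ = All.map ∈-upTo⁻ (∈-words⁻ w w∈)

-- Two enumerations of the proper packed words are matched: the one by content, which Φ produces,
-- and the one letter by letter, which the deletion recursion follows.
Φ-X : ∀ {n} (G : Graph n) → Φ n (X G) ≡ signedCount G
Φ-X {n} G = begin
  Φ n (X G)                 ≡⟨ Φ-series ⟩
  ⅀ packedObjects sign      ≡⟨ ⅀-↭ sign (unique-↭ packedObjects-unique
                                 (Unique.filter⁺ proper₂? (packedWords-unique n)) to from) ⟩
  ⅀ (filter proper₂? (packedWords n)) sign ≡⟨ ⅀-filter proper₂? sign (packedWords n) ⟩
  signedCount G ∎
  where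
  open ≡-Reasoning
  open GeneratingFunction (λ k → words (upTo k) n) toList (proper? G) n
    (λ k → words-unique (Unique.upTo⁺ k) n)
    (λ {k} {w} w∈ → ∈-words-upTo⁻ w w∈ , Vec.length-toList w)
  sign : ℕ × Vec ℕ n → ℚ
  sign kw = sgn (n ℕ.+ proj₁ kw)
  proper₂? : Decidable (λ (kw : ℕ × Vec ℕ n) → Proper G (proj₂ kw))
  proper₂? kw = proper? G (proj₂ kw)

  to : ∀ {kw} → kw ∈ packedObjects → kw ∈ filter proper₂? (packedWords n)
  to {k , w} kw∈ = let _ , p , pk = ∈-packedObjects⁻ kw∈ in
    ∈-filter⁺ proper₂? (∈-packedWords⁺ w pk) p

  from : ∀ {kw} → kw ∈ filter proper₂? (packedWords n) → kw ∈ packedObjects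
  from {k , w} kw∈ = let kw∈′ , p = ∈-filter⁻ proper₂? kw∈ ; pk = ∈-packedWords⁻ w kw∈′ in
    ∈-packedObjects⁺ (∈-words-upTo⁺ w (proj₁ pk)) p pk

Φ-X-positive : ∀ {n} (G : Graph n) → 0ℚ ℚ.< Φ n (X G)
Φ-X-positive G = subst (0ℚ ℚ.<_) (sym (Φ-X G)) (signedCount-positive G)

-- The sign-reversing involution on packed tableaux

unique-map-∈ : ∀ (f : A → B) {xs} → Unique xs →
               (∀ {x y} → x ∈ xs → y ∈ xs → f x ≡ f y → x ≡ y) → Unique (map f xs)
unique-map-∈ f []       inj = []
unique-map-∈ f (x∉ ∷ u) inj =
  All.map⁺ (All.tabulate λ y∈ eq → All.lookup x∉ y∈ (inj (here refl) (there y∈) eq)) ∷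
  unique-map-∈ f u (λ x∈ y∈ → inj (there x∈) (there y∈))

x≡-x⇒x≡0 : ∀ {x} → x ≡ ℚ.- x → x ≡ 0ℚ
x≡-x⇒x≡0 {x} eq with ℚ.<-cmp x 0ℚ
... | tri≈ _ x≡0 _ = x≡0
... | tri< x<0 _ _ = contradiction (subst (0ℚ ℚ.<_) (sym eq) (ℚ.neg-antimono-< x<0)) (ℚ.<-asym x<0)
... | tri> _ _ 0<x = contradiction (subst (ℚ._< 0ℚ) (sym eq) (ℚ.neg-antimono-< 0<x)) (ℚ.<-asym 0<x)

-- Instead of pairing off terms, the sum is reindexed along `ι`, which shows that it equals its own
-- negative.
⅀-sign-reversing : ∀ (f : A → ℚ) {xs} (ι : A → A) → Unique xs →
  (∀ {x} → x ∈ xs → ι x ∈ xs) → (∀ {x} → x ∈ xs → ι (ι x) ≡ x) →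
  (∀ {x} → x ∈ xs → f (ι x) ≡ ℚ.- f x) → ⅀ xs f ≡ 0ℚ
⅀-sign-reversing f {xs} ι u closed invol sign = x≡-x⇒x≡0 (begin
  ⅀ xs f                 ≡⟨ ⅀-↭ f (unique-↭ u
    (unique-map-∈ ι u λ x∈ y∈ eq → trans (sym (invol x∈)) (trans (cong ι eq) (invol y∈)))
    (λ x∈ → subst (_∈ map ι xs) (invol x∈) (∈-map⁺ ι (closed x∈)))
    (λ y∈ → case ∈-map⁻ ι y∈ of λ { (x , x∈ , refl) → closed x∈ })) ⟩
  ⅀ (map ι xs) f         ≡⟨ ⅀-map f ι xs ⟩
  ⅀ xs (f ∘ ι)           ≡⟨ ⅀-cong xs sign ⟩
  ⅀ xs (λ x → ℚ.- f x)   ≡⟨ ⅀-neg f xs ⟩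
  ℚ.- ⅀ xs f             ∎)
  where open ≡-Reasoning

fillings-unique : ∀ k μ → Unique (fillings k μ)
fillings-unique k []      = [] ∷ []
fillings-unique k (m ∷ μ) = Unique.cartesianProductWith⁺ _∷_ List.∷-injective
  (listWords-unique (Unique.upTo⁺ k) m) (fillings-unique k μ)

∈-fillings⁺ : ∀ {k} T → All (All (ℕ._< k)) T → T ∈ fillings k (map length T)
∈-fillings⁺ []      []          = here refl
∈-fillings⁺ (r ∷ T) (r<k ∷ T<k) = ∈-cartesianProductWith⁺ _∷_
  (∈-listWords⁺ r (All.map ∈-upTo⁺ r<k)) (∈-fillings⁺ T T<k)

∈-fillings⁻ : ∀ {k} μ {T} → T ∈ fillings k μ → map length T ≡ μ × All (All (ℕ._< k)) T
∈-fillings⁻ [] (here refl) = refl , []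
∈-fillings⁻ {k} (m ∷ μ) T∈
  with r , T , r∈ , T∈′ , refl ←
         ∈-cartesianProductWith⁻ _∷_ (map toList (words (upTo k) m)) (fillings k μ) T∈
  = let len , r<k = ∈-listWords⁻ r∈ ; shape , T<k = ∈-fillings⁻ μ T∈′ in
    cong₂ _∷_ len shape , All.map ∈-upTo⁻ r<k ∷ T<k

length-concat : ∀ (T : List (List A)) → length (concat T) ≡ sum (map length T)
length-concat []      = refl
length-concat (r ∷ T) =
  trans (List.length-++ r) (cong (length r ℕ.+_) (length-concat T))

-- The involution renames letters by one map on the first column and by another on all further
-- columns, whence this division of the cells.
column core : List (List A) → List A
column T = concat (map (take 1) T)
core   T = concat (map (drop 1) T)

Cells : (C D : ℕ → Set) → List (List ℕ) → Set
Cells C D = All (λ r → All C (take 1 r) × All D (drop 1 r))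

reshapeRow : (f g : ℕ → ℕ) → List ℕ → List ℕ
reshapeRow f g []      = []
reshapeRow f g (h ∷ t) = f h ∷ map g t

reshape : (f g : ℕ → ℕ) → List (List ℕ) → List (List ℕ)
reshape f g = map (reshapeRow f g)

length-reshape : ∀ f g T → map length (reshape f g T) ≡ map length T
length-reshape f g []            = refl
length-reshape f g ([] ∷ T)      = cong (0 ∷_) (length-reshape f g T)
length-reshape f g ((h ∷ t) ∷ T) =
  cong₂ _∷_ (cong suc (List.length-map g t)) (length-reshape f g T)

column-reshape : ∀ f g T → column (reshape f g T) ≡ map f (column T)
column-reshape f g []            = refl
column-reshape f g ([] ∷ T)      = column-reshape f g T
column-reshape f g ((h ∷ t) ∷ T) = cong (f h ∷_) (column-reshape f g T)

core-reshape : ∀ f g T → core (reshape f g T) ≡ map g (core T)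
core-reshape f g []            = refl
core-reshape f g ([] ∷ T)      = core-reshape f g T
core-reshape f g ((h ∷ t) ∷ T) =
  trans (cong (map g t ++_) (core-reshape f g T)) (sym (List.map-++ g t (core T)))

∈-concat-split : ∀ {c : ℕ} T → c ∈ concat T → c ∈ column T ⊎ c ∈ core T
∈-concat-split ([] ∷ T)      c∈          = ∈-concat-split T c∈
∈-concat-split ((h ∷ t) ∷ T) (here refl) = inj₁ (here refl)
∈-concat-split ((h ∷ t) ∷ T) (there c∈) with ∈-++⁻ t c∈
... | inj₁ c∈t = inj₂ (∈-++⁺ˡ c∈t)
... | inj₂ c∈T with ∈-concat-split T c∈T
...   | inj₁ p = inj₁ (there p)
...   | inj₂ p = inj₂ (∈-++⁺ʳ t p)

column⊆concat : ∀ {c : ℕ} T → c ∈ column T → c ∈ concat T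
column⊆concat ([] ∷ T)      c∈          = column⊆concat T c∈
column⊆concat ((h ∷ t) ∷ T) (here refl) = here refl
column⊆concat ((h ∷ t) ∷ T) (there c∈)  = there (∈-++⁺ʳ t (column⊆concat T c∈))

core⊆concat : ∀ {c : ℕ} T → c ∈ core T → c ∈ concat T
core⊆concat ([] ∷ T)      c∈ = core⊆concat T c∈
core⊆concat ((h ∷ t) ∷ T) c∈ with ∈-++⁻ t c∈
... | inj₁ c∈t = there (∈-++⁺ˡ c∈t)
... | inj₂ c∈T = there (∈-++⁺ʳ t (core⊆concat T c∈T))

cells⁺ : ∀ {C D} T → All C (column T) → All D (core T) → Cells C D T
cells⁺ []            _          _  = []
cells⁺ ([] ∷ T)      cs         ds = ([] , []) ∷ cells⁺ T cs ds
cells⁺ ((h ∷ t) ∷ T) (c ∷ cs) ds =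
  (c ∷ [] , All.++⁻ˡ t ds) ∷ cells⁺ T cs (All.++⁻ʳ t ds)

reshape-inverse : ∀ {C D f g f′ g′} → (∀ {a} → C a → f′ (f a) ≡ a) → (∀ {a} → D a → g′ (g a) ≡ a) →
                  ∀ T → Cells C D T → reshape f′ g′ (reshape f g T) ≡ T
reshape-inverse invf invg []            []                    = refl
reshape-inverse invf invg ([] ∷ T)      (_ ∷ cells)           =
  cong ([] ∷_) (reshape-inverse invf invg T cells)
reshape-inverse {g = g} {g′ = g′} invf invg ((h ∷ t) ∷ T) ((c ∷ [] , ds) ∷ cells) =
  cong₂ _∷_ (cong₂ _∷_ (invf c) (inv-map t ds)) (reshape-inverse invf invg T cells)
  where
  inv-map : ∀ t → All _ t → map g′ (map g t) ≡ t
  inv-map []      []       = refl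
  inv-map (a ∷ t) (d ∷ ds) = cong₂ _∷_ (invg d) (inv-map t ds)

module _ {C D : ℕ → Set} {f g : ℕ → ℕ}
  (f-mono : ∀ {a b} → C a → C b → a ℕ.< b → f a ℕ.< f b)
  (g-mono : ∀ {a b} → D a → D b → a ℕ.< b → g a ℕ.< g b)
  (fg-mono : ∀ {a b} → C a → D b → a ℕ.≤ b → f a ℕ.≤ g b) where

  private
    g-mono-≤ : ∀ {a b} → D a → D b → a ℕ.≤ b → g a ℕ.≤ g b
    g-mono-≤ da db a≤b with ℕ.m≤n⇒m<n∨m≡n a≤b
    ... | inj₁ a<b  = ℕ.<⇒≤ (g-mono da db a<b)
    ... | inj₂ refl = ℕ.≤-refl

    weak-core : ∀ {t} → All D t → Linked ℕ._≤_ t → Linked ℕ._≤_ (map g t)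
    weak-core []            []        = []
    weak-core (_ ∷ [])      [-]       = [-]
    weak-core (d ∷ d′ ∷ ds) (le ∷ ls) = g-mono-≤ d d′ le ∷ weak-core (d′ ∷ ds) ls

    weak-row : ∀ r → All C (take 1 r) → All D (drop 1 r) → Linked ℕ._≤_ r →
               Linked ℕ._≤_ (reshapeRow f g r)
    weak-row []          _        _        []        = []
    weak-row (h ∷ [])    _        _        [-]       = [-]
    weak-row (h ∷ a ∷ t) (c ∷ []) (d ∷ ds) (le ∷ ls) = fg-mono c d le ∷ weak-core (d ∷ ds) ls

    strict-core : ∀ {l u} → All D l → All D u → Prefix ℕ._>_ l u → Prefix ℕ._>_ (map g l) (map g u)
    strict-core _        _          []       = []
    strict-core (d ∷ ds) (d′ ∷ ds′) (p ∷ ps) = g-mono d′ d p ∷ strict-core ds ds′ ps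

    strict-row : ∀ {l u} → All C (take 1 l) × All D (drop 1 l) → All C (take 1 u) × All D (drop 1 u) →
                 Prefix ℕ._>_ l u → Prefix ℕ._>_ (reshapeRow f g l) (reshapeRow f g u)
    strict-row _               _                 []       = []
    strict-row (c ∷ [] , ds) (c′ ∷ [] , ds′) (p ∷ ps) = f-mono c′ c p ∷ strict-core ds ds′ ps

    strict-columns : ∀ {T} → Cells C D T → Linked (λ u l → Prefix ℕ._>_ l u) T →
                     Linked (λ u l → Prefix ℕ._>_ l u) (reshape f g T)
    strict-columns []          []       = []
    strict-columns (_ ∷ [])    [-]      = [-]
    strict-columns (c ∷ c′ ∷ cs) (p ∷ ps) = strict-row c′ c p ∷ strict-columns (c′ ∷ cs) ps

    weak-rows : ∀ {T} → Cells C D T → All (Linked ℕ._≤_) T → All (Linked ℕ._≤_) (reshape f g T)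
    weak-rows []               []       = []
    weak-rows {r ∷ _} ((c , d) ∷ cs) (l ∷ ls) = weak-row r c d l ∷ weak-rows cs ls

  -- Strict inequalities compare cells of the same column, hence never cross from the first column
  -- to the rest. Only the first step of a row crosses, and it is weak; so the mixed hypothesis
  -- needs `≤` alone.
  reshape-semistandard : ∀ {T} → Cells C D T → Semistandard T → Semistandard (reshape f g T)
  reshape-semistandard cells (rows , cols) = weak-rows cells rows , strict-columns cells cols

linked-≤-head : ∀ {x t} → Linked ℕ._≤_ (x ∷ t) → All (x ℕ.≤_) t
linked-≤-head [-]       = []
linked-≤-head (le ∷ ls) = le ∷ All.map (ℕ.≤-trans le) (linked-≤-head ls)

prefix-≥ : ∀ {x l u} → Prefix ℕ._>_ l u → All (x ℕ.≤_) u → All (x ℕ.≤_) l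
prefix-≥ []       _          = []
prefix-≥ (p ∷ ps) (le ∷ les) = ℕ.≤-trans le (ℕ.<⇒≤ p) ∷ prefix-≥ ps les

-- The first row increases weakly from its second entry `x`, and increasing columns pass the bound
-- from each row to the one below.
core-≥ : ∀ {h x r T} → Semistandard ((h ∷ x ∷ r) ∷ T) → All (x ℕ.≤_) (core ((h ∷ x ∷ r) ∷ T))
core-≥ {h} {x} {r} {T} ((_ ∷ row) ∷ _ , cols) = let first = ℕ.≤-refl ∷ linked-≤-head row in
  All.++⁺ first (rest (h ∷ x ∷ r) T first cols)
  where
  rest : ∀ u T → All (x ℕ.≤_) (drop 1 u) → Linked (λ u l → Prefix ℕ._>_ l u) (u ∷ T) →
         All (x ℕ.≤_) (core T)
  rest u []            _  _              = []
  rest u ([] ∷ T)      le (_ ∷ cols)     = rest [] T [] cols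
  rest (_ ∷ u) ((h ∷ l) ∷ T) le ((_ ∷ p) ∷ cols) =
    let le′ = prefix-≥ p le in All.++⁺ le′ (rest (h ∷ l) T le′ cols)

shift-mono : ∀ c {a b} → a ℕ.< b → shift c a ℕ.< shift c b
shift-mono zero    a<b                           = ℕ.s<s a<b
shift-mono (suc c) {zero}  {suc b} _             = ℕ.z<s
shift-mono (suc c) {suc a} {suc b} (ℕ.s<s a<b)   = ℕ.s<s (shift-mono c a<b)

shift-≤-suc : ∀ c a → shift c a ℕ.≤ suc a
shift-≤-suc zero    a       = ℕ.≤-refl
shift-≤-suc (suc c) zero    = ℕ.z≤n
shift-≤-suc (suc c) (suc a) = ℕ.s≤s (shift-≤-suc c a)

shift-below : ∀ {c a} → a ℕ.< c → shift c a ≡ a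
shift-below {suc c} {zero}  _           = refl
shift-below {suc c} {suc a} (ℕ.s<s a<c) = cong suc (shift-below a<c)

shift-above : ∀ {c a} → c ℕ.≤ a → shift c a ≡ suc a
shift-above ℕ.z≤n       = refl
shift-above (ℕ.s≤s c≤a) = cong suc (shift-above c≤a)

unshift-below : ∀ {c a} → a ℕ.< c → unshift c a ≡ a
unshift-below {suc c} {zero}  _           = refl
unshift-below {suc c} {suc a} (ℕ.s<s a<c) = cong suc (unshift-below a<c)

unshift-above : ∀ {c a} → c ℕ.≤ a → unshift c (suc a) ≡ a
unshift-above {c} {a} c≤a = trans (cong (unshift c) (sym (shift-above c≤a))) (unshift-shift c a)

unshift-mono : ∀ c {a b} → c ≢ a → c ≢ b → a ℕ.< b → unshift c a ℕ.< unshift c b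
unshift-mono c {a} {b} c≢a c≢b a<b with unshift c b ℕ.≤? unshift c a
... | no  ≰ = ℕ.≰⇒> ≰
... | yes le = contradiction a<b (ℕ.≤⇒≯ (subst₂ ℕ._≤_ (shift-unshift c b c≢b) (shift-unshift c a c≢a)
  (case ℕ.m≤n⇒m<n∨m≡n le of λ where
    (inj₁ lt) → ℕ.<⇒≤ (shift-mono c lt)
    (inj₂ eq) → ℕ.≤-reflexive (cong (shift c) eq))))

unshift-≤-pred : ∀ {x a b} → x ≢ a → x ℕ.≤ b → a ℕ.≤ b → 1 ℕ.≤ x → unshift x a ℕ.≤ ℕ.pred b
unshift-≤-pred {x} {a} {b} x≢a x≤b a≤b 1≤x with ℕ.<-cmp a x
... | tri< a<x _ _ = subst (ℕ._≤ ℕ.pred b) (sym (unshift-below a<x))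
  (ℕ.≤-trans (ℕ.<⇒≤pred a<x) (ℕ.pred-mono-≤ x≤b))
... | tri≈ _ refl _ = contradiction refl x≢a
unshift-≤-pred {x} {suc a} {b} x≢a x≤b a≤b 1≤x | tri> _ _ (ℕ.s<s x≤a) =
  subst (ℕ._≤ ℕ.pred b) (sym (unshift-above x≤a)) (ℕ.pred-mono-≤ a≤b)

Tableau : Set
Tableau = List (List ℕ)

PackedTableau : ℕ → Tableau → Set
PackedTableau k T = Semistandard T × Packed k (concat T)

module _ {k h x : ℕ} {r : List ℕ} {rows : Tableau} where

  private
    T : Tableau
    T = (h ∷ x ∷ r) ∷ rows

    f↑ f↓ : Tableau → Tableau
    f↑ = reshape (shift (suc x)) suc
    f↓ = reshape (unshift x) ℕ.pred

    ∈-reshape-column : ∀ f g {c} → c ∈ column T → f c ∈ concat (reshape f g T)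
    ∈-reshape-column f g {c} c∈ = column⊆concat (reshape f g T)
      (subst (f c ∈_) (sym (column-reshape f g T)) (∈-map⁺ f c∈))

    ∈-reshape-core : ∀ f g {c} → c ∈ core T → g c ∈ concat (reshape f g T)
    ∈-reshape-core f g {c} c∈ = core⊆concat (reshape f g T)
      (subst (g c ∈_) (sym (core-reshape f g T)) (∈-map⁺ g c∈))

    reshape-< : ∀ f g {k′} → (∀ {c} → c ∈ column T → f c ℕ.< k′) → (∀ {c} → c ∈ core T → g c ℕ.< k′) →
                All (ℕ._< k′) (concat (reshape f g T))
    reshape-< f g {k′} f<k′ g<k′ = All.tabulate λ {c} c∈ →
     case ∈-concat-split (reshape f g T) c∈ of λ where
      (inj₁ p) → case ∈-map⁻ f (subst (c ∈_) (column-reshape f g T) p) of λ where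
        (_ , c∈ , refl) → f<k′ c∈
      (inj₂ p) → case ∈-map⁻ g (subst (c ∈_) (core-reshape f g T) p) of λ where
        (_ , c∈ , refl) → g<k′ c∈

  splitTableau mergeTableau : Tableau
  splitTableau = f↑ T
  mergeTableau = f↓ T

  module _ (ss : Semistandard T) (pk : Packed k (concat T)) where
    private
      x≤core : All (x ℕ.≤_) (core T)
      x≤core = core-≥ ss

      <k : ∀ {c} → c ∈ concat T → c ℕ.< k
      <k = All.lookup (proj₁ pk)

      x∈core : x ∈ core T
      x∈core = here refl

      x<k : x ℕ.< k
      x<k = <k (core⊆concat T x∈core)

      -- Packedness makes `c` occur somewhere, and no entry outside the first column is below `x`.
      below-x : ∀ {c} → c ℕ.< x → c ∈ column T
      below-x c<x with ∈-concat-split T (proj₂ pk (ℕ.<-trans c<x x<k))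
      ... | inj₁ c∈ = c∈
      ... | inj₂ c∈ = contradiction c<x (ℕ.≤⇒≯ (All.lookup x≤core c∈))

      cells↑ : Cells (λ _ → ⊤) (x ℕ.≤_) T
      cells↑ = cells⁺ T (All.tabulate λ _ → tt) x≤core

    split-packed : x ∈ column T → PackedTableau (suc k) splitTableau
    split-packed x∈col =
      reshape-semistandard (λ _ _ → shift-mono (suc x)) (λ _ _ → ℕ.s<s)
        (λ {a} _ _ a≤b → ℕ.≤-trans (shift-≤-suc (suc x) a) (ℕ.s≤s a≤b)) cells↑ ss ,
      reshape-< (shift (suc x)) suc (λ c∈ → shift-< (<k (column⊆concat T c∈)))
        (λ c∈ → ℕ.s<s (<k (core⊆concat T c∈))) ,
      onto
      where
      low : ∀ {c} → c ℕ.≤ x → c ∈ column T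
      low c≤x with ℕ.m≤n⇒m<n∨m≡n c≤x
      ... | inj₁ c<x  = below-x c<x
      ... | inj₂ refl = x∈col

      -- Letters up to `x` stay in the first column, `suc x` is the image of the `x` in the first
      -- row, and each larger letter is the image of its predecessor.
      onto : ∀ {c} → c ℕ.< suc k → c ∈ concat splitTableau
      onto {c} c≤k with c ℕ.≤? x
      ... | yes c≤x = subst (_∈ concat splitTableau) (shift-below (ℕ.s≤s c≤x))
        (∈-reshape-column (shift (suc x)) suc (low c≤x))
      onto {zero}  c≤k         | no c≰x = contradiction ℕ.z≤n c≰x
      onto {suc c} (ℕ.s<s c<k) | no c≰x with ℕ.m≤n⇒m<n∨m≡n (ℕ.s≤s⁻¹ (ℕ.≰⇒> c≰x))
      ... | inj₂ refl = ∈-reshape-core (shift (suc x)) suc x∈core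
      ... | inj₁ x<c with ∈-concat-split T (proj₂ pk c<k)
      ...   | inj₁ c∈ = subst (_∈ concat splitTableau) (shift-above x<c)
        (∈-reshape-column (shift (suc x)) suc c∈)
      ...   | inj₂ c∈ = ∈-reshape-core (shift (suc x)) suc c∈

    -- The map `shift (suc x)` omits `suc x`, which is the second entry of the new first row. So the
    -- next application of the involution takes the merging branch.
    split-column : suc x ∉ column splitTableau
    split-column p with a , _ , eq ← ∈-map⁻ (shift (suc x))
                          (subst (suc x ∈_) (column-reshape (shift (suc x)) suc T) p)
      = c≢shift (suc x) a eq

    merge-split : reshape (unshift (suc x)) ℕ.pred splitTableau ≡ T
    merge-split = reshape-inverse (λ {a} _ → unshift-shift (suc x) a) (λ _ → refl) T cells↑

    module _ (x∉ : x ∉ column T) where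
      private
        -- The corner entry `h` is at most `x`, so `x` = 0 would force `h` = `x` and put `x` into
        -- the first column.
        1≤x : 1 ℕ.≤ x
        1≤x with ℕ.m≤n⇒m<n∨m≡n (ℕ.z≤n {x})
        ... | inj₁ 0<x  = 0<x
        ... | inj₂ refl with (h≤x ∷ _) ∷ _ ← proj₁ ss = contradiction (here (sym (ℕ.n≤0⇒n≡0 h≤x))) x∉

        spx : suc (ℕ.pred x) ≡ x
        spx = ℕ.suc-pred x {{ℕ.>-nonZero 1≤x}}

        D : ℕ → Set
        D a = x ℕ.≤ a

        1≤D : ∀ {a} → D a → 1 ℕ.≤ a
        1≤D = ℕ.≤-trans 1≤x

        suc-pred-D : ∀ {a} → D a → suc (ℕ.pred a) ≡ a
        suc-pred-D d = ℕ.suc-pred _ {{ℕ.>-nonZero (1≤D d)}}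

        x≢column : All (x ≢_) (column T)
        x≢column = All.tabulate λ { c∈ refl → x∉ c∈ }

        cells↓ : Cells (x ≢_) D T
        cells↓ = cells⁺ T x≢column x≤core

      merge-suc : k ≡ suc (ℕ.pred k)
      merge-suc = sym (ℕ.suc-pred k {{ℕ.>-nonZero (ℕ.≤-<-trans ℕ.z≤n x<k)}})

      private
        ≤k : ∀ {c} → c ∈ concat T → c ℕ.< suc (ℕ.pred k)
        ≤k c∈ = subst (_ ℕ.<_) merge-suc (<k c∈)

      merge-packed : PackedTableau (ℕ.pred k) mergeTableau
      merge-packed =
        reshape-semistandard (unshift-mono x)
          (λ da _ a<b → ℕ.pred-mono-< {{ℕ.>-nonZero (1≤D da)}} a<b)
          (λ x≢a d a≤b → unshift-≤-pred x≢a d a≤b 1≤x) cells↓ ss ,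
        reshape-< (unshift x) ℕ.pred
          (λ c∈ → unshift-< (All.lookup x≢column c∈) (≤k (core⊆concat T x∈core))
            (≤k (column⊆concat T c∈)))
          (λ {c} c∈ → ℕ.s<s⁻¹ (subst (ℕ._< suc (ℕ.pred k))
            (sym (suc-pred-D (All.lookup x≤core c∈))) (≤k (core⊆concat T c∈)))) ,
        onto
        where
        onto : ∀ {c} → c ℕ.< ℕ.pred k → c ∈ concat mergeTableau
        onto {c} c<k with c ℕ.<? x
        ... | yes c<x = subst (_∈ concat mergeTableau) (unshift-below c<x)
          (∈-reshape-column (unshift x) ℕ.pred (below-x c<x))
        ... | no c≮x with ∈-concat-split T (proj₂ pk (subst (suc c ℕ.<_) (sym merge-suc) (ℕ.s<s c<k)))
        ...   | inj₁ c∈ = subst (_∈ concat mergeTableau) (unshift-above (ℕ.≮⇒≥ c≮x))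
          (∈-reshape-column (unshift x) ℕ.pred c∈)
        ...   | inj₂ c∈ = ∈-reshape-core (unshift x) ℕ.pred c∈

      -- The letter x - 1 lies in the first column like all letters below `x`, and merging leaves it
      -- in place there. It is also the second entry of the new first row, so the next application
      -- takes the splitting branch.
      merge-column : ℕ.pred x ∈ column mergeTableau
      merge-column = subst (ℕ.pred x ∈_) (sym (column-reshape (unshift x) ℕ.pred T))
        (subst (_∈ map (unshift x) (column T)) (unshift-below px<x)
          (∈-map⁺ (unshift x) (below-x px<x)))
        where
        px<x : ℕ.pred x ℕ.< x
        px<x = subst (ℕ.pred x ℕ.<_) spx ℕ.≤-refl

      split-merge : reshape (shift (suc (ℕ.pred x))) suc mergeTableau ≡ T
      split-merge = trans (cong (λ y → reshape (shift y) suc mergeTableau) spx)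
        (reshape-inverse (λ {a} → shift-unshift x a) suc-pred-D T cells↓)

-- With x the second entry of the first row, all entries below x lie in the first column.  If x
-- lies there too, it is separated from the other entries x, which become x + 1; otherwise x - 1
-- occurs in the first column only, and it is merged with x.
toggle : ∀ k h x r rows → Dec (x ∈ column ((h ∷ x ∷ r) ∷ rows)) → ℕ × Tableau
toggle k h x r rows (yes _) = suc k , reshape (shift (suc x)) suc ((h ∷ x ∷ r) ∷ rows)
toggle k h x r rows (no _)  = ℕ.pred k , reshape (unshift x) ℕ.pred ((h ∷ x ∷ r) ∷ rows)

involution : ℕ × Tableau → ℕ × Tableau
involution (k , (h ∷ x ∷ r) ∷ rows) = toggle k h x r rows (x ∈? column ((h ∷ x ∷ r) ∷ rows))
-- A default value: a tableau of a wide shape has a second cell in its first row.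
involution kT                       = kT

toggle-yes : ∀ {k h x r rows} (x∈? : Dec _) → x ∈ column ((h ∷ x ∷ r) ∷ rows) →
  toggle k h x r rows x∈? ≡ (suc k , reshape (shift (suc x)) suc ((h ∷ x ∷ r) ∷ rows))
toggle-yes (yes _) x∈ = refl
toggle-yes (no x∉) x∈ = contradiction x∈ x∉

toggle-no : ∀ {k h x r rows} (x∈? : Dec _) → x ∉ column ((h ∷ x ∷ r) ∷ rows) →
  toggle k h x r rows x∈? ≡ (ℕ.pred k , reshape (unshift x) ℕ.pred ((h ∷ x ∷ r) ∷ rows))
toggle-no (yes x∈) x∉ = contradiction x∈ x∉
toggle-no (no _)   x∉ = refl

module _ (n : ℕ) (μ : List ℕ) (|μ| : sum μ ≡ n) where

  private
    fillings-word : ∀ {k T} → T ∈ fillings k μ →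
                    All (ℕ._< k) (concat T) × length (concat T) ≡ n
    fillings-word {T = T} T∈ = let shape , T<k = ∈-fillings⁻ μ T∈ in
      All.concat⁺ T<k , trans (length-concat T) (trans (cong sum shape) |μ|)

  open GeneratingFunction (λ k → fillings k μ) concat semistandard? n
    (λ k → fillings-unique k μ) fillings-word

  private
    sign : ℕ × Tableau → ℚ
    sign kT = sgn (n ℕ.+ proj₁ kT)

    packed⁻ : ∀ {k T} → (k , T) ∈ packedObjects → map length T ≡ μ × PackedTableau k T
    packed⁻ kT∈ = let T∈ , ss , pk = ∈-packedObjects⁻ kT∈ in proj₁ (∈-fillings⁻ μ T∈) , ss , pk

    packed⁺ : ∀ {k T} → map length T ≡ μ → PackedTableau k T → (k , T) ∈ packedObjects
    packed⁺ {k} {T} shape (ss , pk) = ∈-packedObjects⁺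
      (subst (λ ν → T ∈ fillings k ν) shape (∈-fillings⁺ T (All.concat⁻ (proj₁ pk)))) ss pk

  Φ-s-wide : ∀ {a ν} → μ ≡ suc (suc a) ∷ ν → Φ n (s μ) ≡ 0ℚ
  Φ-s-wide {a} {ν} refl = trans Φ-series
    (⅀-sign-reversing sign involution packedObjects-unique closed invol reverses)
    where
    closed : ∀ {kT} → kT ∈ packedObjects → involution kT ∈ packedObjects
    closed {k , (h ∷ x ∷ r) ∷ rows} kT∈
      with shape , ss , pk ← packed⁻ kT∈ | x ∈? column ((h ∷ x ∷ r) ∷ rows)
    ... | yes x∈ = packed⁺ (trans (length-reshape _ _ ((h ∷ x ∷ r) ∷ rows)) shape)
      (split-packed ss pk x∈)
    ... | no x∉  = packed⁺ (trans (length-reshape _ _ ((h ∷ x ∷ r) ∷ rows)) shape)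
      (merge-packed ss pk x∉)
    closed {k , []}             kT∈ = kT∈
    closed {k , [] ∷ rows}      kT∈ = kT∈
    closed {k , (_ ∷ []) ∷ rows} kT∈ = kT∈

    invol : ∀ {kT} → kT ∈ packedObjects → involution (involution kT) ≡ kT
    invol {k , (h ∷ x ∷ r) ∷ rows} kT∈
      with shape , ss , pk ← packed⁻ kT∈ | x ∈? column ((h ∷ x ∷ r) ∷ rows)
    ... | yes x∈ = trans (toggle-no (suc x ∈? _) (split-column ss pk))
      (cong (k ,_) (merge-split ss pk))
    ... | no x∉  = trans (toggle-yes (ℕ.pred x ∈? _) (merge-column ss pk x∉))
      (cong₂ _,_ (sym (merge-suc ss pk x∉)) (split-merge ss pk x∉))
    invol {k , []}              kT∈ = refl
    invol {k , [] ∷ rows}       kT∈ = refl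
    invol {k , (_ ∷ []) ∷ rows} kT∈ = refl

    reverses : ∀ {kT} → kT ∈ packedObjects → sign (involution kT) ≡ ℚ.- sign kT
    reverses {k , (h ∷ x ∷ r) ∷ rows} kT∈
      with shape , ss , pk ← packed⁻ kT∈ | x ∈? column ((h ∷ x ∷ r) ∷ rows)
    ... | yes x∈ = cong sgn (ℕ.+-suc n k)
    ... | no x∉  = trans (sym (neg-involutive _)) (cong ℚ.-_
      (trans (sym (cong sgn (ℕ.+-suc n (ℕ.pred k))))
        (cong (λ j → sgn (n ℕ.+ j)) (sym (merge-suc ss pk x∉)))))
    reverses {k , []}              kT∈ = case proj₁ (packed⁻ kT∈) of λ ()
    reverses {k , [] ∷ rows}       kT∈ = case proj₁ (packed⁻ kT∈) of λ ()
    reverses {k , (_ ∷ []) ∷ rows} kT∈ = case proj₁ (packed⁻ kT∈) of λ ()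

  -- A strictly increasing column of n cells needs at least n letters, and a packed word of length n
  -- has at most n. So k = n in every term, and every sign is (-1)^(2n).
  Φ-s-column : μ ≡ replicate n 1 → 0ℚ ℚ.≤ Φ n (s μ)
  Φ-s-column refl = subst (0ℚ ℚ.≤_) (sym Φ-series) (⅀-nonneg packedObjects nonneg)
    where
    height : ∀ {k a T} → Semistandard ((a ∷ []) ∷ T) → All (λ r → length r ≡ 1) T →
             All (ℕ._< k) (concat ((a ∷ []) ∷ T)) → a ℕ.+ length T ℕ.< k
    height {k} {a} {[]} ss [] (a<k ∷ []) = subst (ℕ._< k) (sym (ℕ.+-identityʳ a)) a<k
    height {k} {a} {(b ∷ []) ∷ T} (_ ∷ rows , (a<b ∷ _) ∷ cols) (_ ∷ lens) (_ ∷ T<k) =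
      ℕ.≤-<-trans (subst (ℕ._≤ b ℕ.+ length T) (sym (ℕ.+-suc a (length T)))
        (ℕ.+-monoˡ-≤ (length T) a<b)) (height (rows , cols) lens T<k)

    height-≤ : ∀ {k} T → Semistandard T → All (λ r → length r ≡ 1) T →
               All (ℕ._< k) (concat T) → length T ℕ.≤ k
    height-≤ []               _  _          _   = ℕ.z≤n
    height-≤ ((a ∷ []) ∷ T) ss (_ ∷ lens) T<k =
      ℕ.≤-<-trans (ℕ.m≤n+m (length T) a) (height ss lens T<k)

    n≤k : ∀ {k T} → map length T ≡ replicate n 1 → PackedTableau k T → n ℕ.≤ k
    n≤k {k} {T} shape (ss , T<k , _) = subst (ℕ._≤ k)
      (trans (sym (List.length-map length T)) (trans (cong length shape) (List.length-replicate n)))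
      (height-≤ T ss
        (All.map⁻ (subst (All (_≡ 1)) (sym shape) (All.replicate⁺ n refl))) T<k)

    sgn-even : ∀ m → sgn (m ℕ.+ m) ≡ 1ℚ
    sgn-even zero    = refl
    sgn-even (suc m) = trans (cong (ℚ.-_ ∘ sgn) (ℕ.+-suc m m))
      (trans (neg-involutive (sgn (m ℕ.+ m))) (sgn-even m))

    nonneg : ∀ {kT} → kT ∈ packedObjects → 0ℚ ℚ.≤ sign kT
    nonneg {k , T} kT∈ with shape , pT@(_ , pk) ← packed⁻ kT∈
      with refl ← ℕ.≤-antisym (n≤k shape pT) (subst (k ℕ.≤_)
        (trans (length-concat T) (trans (cong sum shape) |μ|)) (packed-≤ (concat T) pk))
      = subst (0ℚ ℚ.≤_) (sym (sgn-even n)) (ℚ.nonNegative⁻¹ 1ℚ)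

-- The coefficient of s_(1ⁿ) in X_G

column-or-wide : ∀ {n} μ → μ ⊢ n → μ ≡ replicate n 1 ⊎ ∃ λ a → ∃ λ ν → μ ≡ suc (suc a) ∷ ν
column-or-wide [] (refl , _ , _) = inj₁ refl
column-or-wide (zero ∷ μ) (_ , () ∷ _ , _)
column-or-wide (suc (suc a) ∷ μ) _ = inj₂ (a , μ , refl)
column-or-wide (suc zero ∷ μ) (refl , _ ∷ pos , dec) = inj₁ (cong (1 ∷_) (ones pos dec))
  where
  ones : ∀ {μ} → All (1 ℕ.≤_) μ → Linked _≥_ (1 ∷ μ) → μ ≡ replicate (sum μ) 1
  ones []          _                         = refl
  ones (1≤m ∷ pos) (m≤1 ∷ dec) with refl ← ℕ.≤-antisym m≤1 1≤m = cong (1 ∷_) (ones pos dec)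

∈-partitions⁻ : ∀ n {μ} → μ ∈ partitions n → μ ⊢ n
∈-partitions⁻ n = proj₂ ∘ ∈-filter⁻ (_⊢? n) {xs = compositions n}

Φ-expansion : ∀ {n F} (e : SchurExpansion n F) →
              Φ n F ≡ ⅀ (partitions n) (λ μ → coeff e μ ℚ.* Φ n (s μ))
Φ-expansion {n} {F} e = begin
  Φ n F ≡⟨ ⅀-cong (compositions n) (λ {α} _ → trans
    (cong (σ α ℚ.*_) (expands e α)) (sym (⅀-*ˡ (σ α) _ (partitions n)))) ⟩
  ⅀ (compositions n) (λ α → ⅀ (partitions n) λ μ → σ α ℚ.* (coeff e μ ℚ.* s μ α))
    ≡⟨ ⅀-swap _ (compositions n) (partitions n) ⟩
  ⅀ (partitions n) (λ μ → ⅀ (compositions n) λ α → σ α ℚ.* (coeff e μ ℚ.* s μ α))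
    ≡⟨ ⅀-cong (partitions n) (λ {μ} _ → trans
      (⅀-cong (compositions n) λ {α} _ → x∙yz≈y∙xz (σ α) (coeff e μ) (s μ α))
      (⅀-*ˡ (coeff e μ) _ (compositions n))) ⟩
  ⅀ (partitions n) (λ μ → coeff e μ ℚ.* Φ n (s μ)) ∎
  where
  open ≡-Reasoning
  open import Algebra.Properties.CommutativeSemigroup
    (CommutativeMonoid.commutativeSemigroup ℚ.*-1-commutativeMonoid) using (x∙yz≈y∙xz)
  σ : List ℕ → ℚ
  σ α = sgn (n ℕ.+ length α)

-- Applying Φ to the given expansion yields a positive sum, hence a positive term. Terms of wide
-- shapes vanish, so it is the term of (1ⁿ); as Φ(s_(1ⁿ)) ≥ 0, a coefficient ≤ 0 could not make it
-- positive.
coeff-1ⁿ-positive : ∀ {n} (G : Graph n) (e : SchurExpansion n (X G)) → 0ℚ ℚ.< coeff e (replicate n 1)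
coeff-1ⁿ-positive {n} G e =
  let μ , μ∈ , pos = ⅀-pos-witness {f = term} (partitions n)
                       (subst (0ℚ ℚ.<_) (Φ-expansion e) (Φ-X-positive G))
      μ⊢n = ∈-partitions⁻ n μ∈
  in positive μ (proj₁ μ⊢n) (column-or-wide μ μ⊢n) pos
  where
  term : List ℕ → ℚ
  term μ = coeff e μ ℚ.* Φ n (s μ)

  positive : ∀ μ → sum μ ≡ n → μ ≡ replicate n 1 ⊎ (∃ λ a → ∃ λ ν → μ ≡ suc (suc a) ∷ ν) →
             0ℚ ℚ.< term μ → 0ℚ ℚ.< coeff e (replicate n 1)
  positive μ |μ| (inj₂ (_ , _ , wide)) pos = contradiction pos (ℚ.<-irrefl (sym
    (trans (cong (coeff e μ ℚ.*_) (Φ-s-wide n μ |μ| wide)) (ℚ.*-zeroʳ (coeff e μ)))))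
  positive μ |μ| (inj₁ column) pos = subst (λ ν → 0ℚ ℚ.< coeff e ν) column (ℚ.≰⇒> λ c≤0 →
    ℚ.<-irrefl refl (ℚ.<-≤-trans pos (subst (term μ ℚ.≤_) (ℚ.*-zeroˡ (Φ n (s μ)))
      (ℚ.*-monoʳ-≤-nonNeg (Φ n (s μ)) {{ℚ.nonNegative (Φ-s-column n μ |μ| column)}} c≤0))))

-- Tableaux in two letters

module _ {P : A → Set} (P? : Decidable P) where

  count-nonneg : ∀ xs → 0ℚ ℚ.≤ count P? xs
  count-nonneg xs = fromℕℚ-nonneg (length (filter P? xs))

  count-positive⁺ : ∀ {xs x} → x ∈ xs → P x → 0ℚ ℚ.< count P? xs
  count-positive⁺ {xs} x∈ px with length (filter P? xs) | filter-pos P? x∈ px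
  ... | suc m | _ = fromℕℚ-pos m

  count-positive⁻ : ∀ {xs} → 0ℚ ℚ.< count P? xs → ∃ λ x → x ∈ xs × P x
  count-positive⁻ {xs} pos = filter-pos⁻ P? xs (ℕ.n≢0⇒n>0 λ len≡0 →
    ℚ.<-irrefl refl (subst (λ m → 0ℚ ℚ.< fromℕℚ m) len≡0 pos))

occ-++ : ∀ c v w → occ c (v ++ w) ≡ occ c v ℕ.+ occ c w
occ-++ c v w = trans (cong length (List.filter-++ (c ℕ.≟_) v w)) (List.length-++ (filter (c ℕ.≟_) v))

occ-≡ : ∀ c w → occ c (c ∷ w) ≡ suc (occ c w)
occ-≡ c w = cong length (List.filter-accept (c ℕ.≟_) refl)

occ-≢ : ∀ {c x} w → c ≢ x → occ c (x ∷ w) ≡ occ c w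
occ-≢ {c} w c≢x = cong length (List.filter-reject (c ℕ.≟_) c≢x)

∈-zeros : ∀ j {P : ℕ → Set} {w} → P 0 → All P w → All P (replicate j 0 ++ w)
∈-zeros j p ps = All.++⁺ (All.replicate⁺ j p) ps

occ-0-zeros : ∀ j w → occ 0 (replicate j 0 ++ w) ≡ j ℕ.+ occ 0 w
occ-0-zeros zero    w = refl
occ-0-zeros (suc j) w = cong suc (occ-0-zeros j w)

occ-1-zeros : ∀ j w → occ 1 (replicate j 0 ++ w) ≡ occ 1 w
occ-1-zeros zero    w = refl
occ-1-zeros (suc j) w = occ-1-zeros j w

linked-zeros : ∀ j {w} → Linked ℕ._≤_ w → Linked ℕ._≤_ (replicate j 0 ++ w)
linked-zeros zero          l = l
linked-zeros (suc zero)    []      = [-]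
linked-zeros (suc zero)    [-]     = ℕ.z≤n ∷ [-]
linked-zeros (suc zero)    (p ∷ l) = ℕ.z≤n ∷ p ∷ l
linked-zeros (suc (suc j)) l = ℕ.z≤n ∷ linked-zeros (suc j) l

length-zeros : ∀ j (w : List ℕ) → length (replicate j 0 ++ w) ≡ j ℕ.+ length w
length-zeros j w =
  trans (List.length-++ (replicate j 0)) (cong (ℕ._+ length w) (List.length-replicate j))

-- With letters 0 and 1 a column has at most two cells, and every cell of a second row holds a 1.
-- The content admits a single 1, so the second row has at most one cell.
hook-shape : ∀ {n a} μ T → μ ⊢ n → map length T ≡ μ → All (All (ℕ._< 2)) T → Semistandard T →
             HasMonomial (a ∷ 1 ∷ []) (concat T) → μ ≡ n ∷ [] ⊎ ∃ λ m → μ ≡ m ∷ 1 ∷ [] × m ℕ.+ 1 ≡ n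
hook-shape _ [] _ _ _ _ ()
hook-shape {n} _ (u ∷ []) (sum≡n , _) refl _ _ _ =
  inj₁ (cong (_∷ []) (trans (sym (ℕ.+-identityʳ (length u))) sum≡n))
hook-shape _ (u ∷ [] ∷ T) (_ , _ ∷ () ∷ _ , _) refl _ _ _
hook-shape _ (u ∷ (b ∷ []) ∷ []) (sum≡n , _) refl _ _ _ = inj₂ (length u , refl , sum≡n)
hook-shape _ (u ∷ (b ∷ []) ∷ [] ∷ T) (_ , _ ∷ _ ∷ () ∷ _ , _) refl _ _ _
hook-shape _ ((a ∷ u) ∷ (b ∷ []) ∷ (c ∷ _) ∷ T) _ refl (_ ∷ _ ∷ (c<2 ∷ _) ∷ _)
  (_ , (a<b ∷ _) ∷ (b<c ∷ _) ∷ _) _ =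
  contradiction c<2 (ℕ.≤⇒≯ (ℕ.≤-trans (ℕ.s≤s (ℕ.≤-<-trans ℕ.z≤n a<b)) b<c))
hook-shape _ ((a ∷ a′ ∷ u) ∷ (b ∷ b′ ∷ l) ∷ T) _ refl (_ ∷ (b<2 ∷ b′<2 ∷ _) ∷ _)
  (_ , (a<b ∷ a′<b′ ∷ _) ∷ _) mono
  with refl ← ℕ.≤-antisym (ℕ.s≤s⁻¹ b<2) (ℕ.≤-<-trans ℕ.z≤n a<b)
  with refl ← ℕ.≤-antisym (ℕ.s≤s⁻¹ b′<2) (ℕ.≤-<-trans ℕ.z≤n a′<b′)
  = contradiction (subst (2 ℕ.≤_)
      (trans (sym (occ-++ 1 (a ∷ a′ ∷ u) (1 ∷ 1 ∷ l ++ concat T)))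
        (List.∷-injectiveˡ (List.∷-injectiveʳ mono)))
      (ℕ.≤-trans (ℕ.s≤s (ℕ.s≤s ℕ.z≤n)) (ℕ.m≤n+m (2 ℕ.+ occ 1 (l ++ concat T)) (occ 1 (a ∷ a′ ∷ u)))))
      λ { (ℕ.s≤s ()) }

-- K_{μ,(n-1,1)} > 0 only for μ = (n) and μ = (n-1,1), and these dominate (n-2,2).
kostka-positive : ∀ m μ → μ ⊢ 4 ℕ.+ m → 0ℚ ℚ.< s μ (3 ℕ.+ m ∷ 1 ∷ []) → 0ℚ ℚ.< s μ (2 ℕ.+ m ∷ 2 ∷ [])
kostka-positive m μ μ⊢n pos =
  let T , T∈ , ss , mono = count-positive⁻ _ {fillings 2 μ} pos
      shape , T<2 = ∈-fillings⁻ μ T∈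
  in conclude (hook-shape μ T μ⊢n shape T<2 ss mono)
  where
  zeros : List ℕ → List ℕ
  zeros w = replicate (2 ℕ.+ m) 0 ++ w

  conclude : μ ≡ 4 ℕ.+ m ∷ [] ⊎ (∃ λ k → μ ≡ k ∷ 1 ∷ [] × k ℕ.+ 1 ≡ 4 ℕ.+ m) →
             0ℚ ℚ.< s μ (2 ℕ.+ m ∷ 2 ∷ [])
  conclude (inj₁ refl) = count-positive⁺ _
    (subst (λ k → T ∈ fillings 2 (k ∷ []))
      (trans (length-zeros (2 ℕ.+ m) (1 ∷ 1 ∷ [])) (ℕ.+-comm (2 ℕ.+ m) 2))
      (∈-fillings⁺ T (∈-zeros (2 ℕ.+ m) ℕ.z<s (ℕ.≤-refl ∷ ℕ.≤-refl ∷ []) ∷ [])))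
    ((linked-zeros (2 ℕ.+ m) (ℕ.≤-refl ∷ [-]) ∷ [] , [-]) ,
     subst (HasMonomial (2 ℕ.+ m ∷ 2 ∷ [])) (sym (List.++-identityʳ (zeros (1 ∷ 1 ∷ []))))
       (cong₂ (λ i j → i ∷ j ∷ [])
         (trans (occ-0-zeros (2 ℕ.+ m) (1 ∷ 1 ∷ [])) (ℕ.+-identityʳ _))
         (occ-1-zeros (2 ℕ.+ m) (1 ∷ 1 ∷ []))))
    where
    T : Tableau
    T = zeros (1 ∷ 1 ∷ []) ∷ []
  conclude (inj₂ (k , refl , k+1≡)) = count-positive⁺ _
    (subst (λ k → T ∈ fillings 2 (k ∷ 1 ∷ []))
      (trans (length-zeros (2 ℕ.+ m) (1 ∷ [])) (trans (ℕ.+-comm (2 ℕ.+ m) 1)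
        (ℕ.suc-injective (trans (sym k+1≡) (ℕ.+-comm k 1)))))
      (∈-fillings⁺ T (∈-zeros (2 ℕ.+ m) ℕ.z<s (ℕ.≤-refl ∷ []) ∷ (ℕ.≤-refl ∷ []) ∷ [])))
    ((linked-zeros (2 ℕ.+ m) [-] ∷ [-] ∷ [] , (ℕ.z<s ∷ []) ∷ [-]) ,
     cong₂ (λ i j → i ∷ j ∷ [])
       (trans (occ-++ 0 (zeros (1 ∷ [])) (1 ∷ []))
         (trans (ℕ.+-identityʳ _) (trans (occ-0-zeros (2 ℕ.+ m) (1 ∷ [])) (ℕ.+-identityʳ _))))
       (trans (occ-++ 1 (zeros (1 ∷ [])) (1 ∷ [])) (cong (ℕ._+ 1) (occ-1-zeros (2 ℕ.+ m) (1 ∷ [])))))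
    where
    T : Tableau
    T = zeros (1 ∷ []) ∷ (1 ∷ []) ∷ []

-- Two-coloured stars

∈-toList⁻ : ∀ {n} {x : A} (κ : Vec A n) → x ∈ toList κ → ∃ λ i → lookup κ i ≡ x
∈-toList⁻ (x Vec.∷ κ) (here refl) = zero , refl
∈-toList⁻ (x Vec.∷ κ) (there x∈) = let i , eq = ∈-toList⁻ κ x∈ in suc i , eq

two-occurrences⁺ : ∀ {n c} (κ : Vec ℕ n) i j → i ≢ j → lookup κ i ≡ c → lookup κ j ≡ c →
                   2 ℕ.≤ occ c (toList κ)
two-occurrences⁺ (x Vec.∷ κ) zero    zero    i≢j _    _    = contradiction refl i≢j
two-occurrences⁺ (x Vec.∷ κ) zero    (suc j) i≢j refl refl =
  subst (2 ℕ.≤_) (sym (occ-≡ x (toList κ))) (ℕ.s≤s (occ-pos (∈-toList j κ)))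
two-occurrences⁺ (x Vec.∷ κ) (suc i) zero    i≢j refl refl =
  subst (2 ℕ.≤_) (sym (occ-≡ x (toList κ))) (ℕ.s≤s (occ-pos (∈-toList i κ)))
two-occurrences⁺ {c = c} (x Vec.∷ κ) (suc i) (suc j) i≢j eqi eqj = ℕ.≤-trans
  (two-occurrences⁺ κ i j (i≢j ∘ cong suc) eqi eqj)
  (case c ℕ.≟ x of λ where
    (yes refl) → subst (occ c (toList κ) ℕ.≤_) (sym (occ-≡ c (toList κ))) (ℕ.n≤1+n _)
    (no c≢x)   → ℕ.≤-reflexive (sym (occ-≢ (toList κ) c≢x)))

two-occurrences⁻ : ∀ {n c} (κ : Vec ℕ n) i → lookup κ i ≡ c → 2 ℕ.≤ occ c (toList κ) →
                   ∃ λ j → i ≢ j × lookup κ j ≡ c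
two-occurrences⁻ (x Vec.∷ κ) zero refl 2≤ =
  let j , eq = ∈-toList⁻ κ (occ-pos⁻ (ℕ.s≤s⁻¹ (subst (2 ℕ.≤_) (occ-≡ x (toList κ)) 2≤)))
  in suc j , (λ ()) , eq
two-occurrences⁻ {c = c} (x Vec.∷ κ) (suc i) eq 2≤ = case c ℕ.≟ x of λ where
  (yes refl) → zero , (λ ()) , refl
  (no c≢x)   → let j , i≢j , eq′ = two-occurrences⁻ κ i eq (subst (2 ℕ.≤_) (occ-≢ (toList κ) c≢x) 2≤)
               in suc j , i≢j ∘ Fin.suc-injective , eq′

starWord : ∀ m → Vec ℕ (suc m)
starWord zero    = 1 Vec.∷ Vec.[]
starWord (suc m) = 0 Vec.∷ starWord m

starWord-centre : ∀ m i → IsCentre i → lookup (starWord m) i ≡ 1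
starWord-centre zero    zero    _  = refl
starWord-centre (suc m) (suc i) eq = starWord-centre m i (ℕ.suc-injective eq)

starWord-leaf : ∀ m i → ¬ IsCentre i → lookup (starWord m) i ≡ 0
starWord-leaf zero    zero    ¬c = contradiction refl ¬c
starWord-leaf (suc m) zero    ¬c = refl
starWord-leaf (suc m) (suc i) ¬c = starWord-leaf m i (¬c ∘ cong suc)

starWord-monomial : ∀ m → HasMonomial (m ∷ 1 ∷ []) (toList (starWord m))
starWord-monomial zero    = refl
starWord-monomial (suc m) = cong₂ (λ i j → suc i ∷ j ∷ [])
  (List.∷-injectiveˡ (starWord-monomial m))
  (List.∷-injectiveˡ (List.∷-injectiveʳ (starWord-monomial m)))

starWord-<2 : ∀ m → All (ℕ._< 2) (toList (starWord m))
starWord-<2 zero    = ℕ.≤-refl ∷ []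
starWord-<2 (suc m) = ℕ.z<s ∷ starWord-<2 m

centre-unique : ∀ {n} {i j : Fin n} → IsCentre i → IsCentre j → i ≡ j
centre-unique ci cj = Fin.toℕ-injective (ℕ.suc-injective (trans ci (sym cj)))

starWord-proper : ∀ m → Proper (starGraph (suc m)) (starWord m)
starWord-proper m i j (i≢j , inj₁ ci) eq = case trans (sym (starWord-centre m i ci))
  (trans eq (starWord-leaf m j λ cj → i≢j (centre-unique ci cj))) of λ ()
starWord-proper m i j (i≢j , inj₂ cj) eq = case trans (sym (starWord-centre m j cj))
  (trans (sym eq) (starWord-leaf m i λ ci → i≢j (centre-unique ci cj))) of λ ()

X-star-positive : ∀ m → 0ℚ ℚ.< X (starGraph (suc m)) (m ∷ 1 ∷ [])
X-star-positive m = count-positive⁺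
  (λ κ → proper? (starGraph (suc m)) κ ×-dec hasMonomial? (m ∷ 1 ∷ []) (toList κ))
  {words (upTo 2) (suc m)}
  (∈-words-upTo⁺ (starWord m) (starWord-<2 m)) (starWord-proper m , starWord-monomial m)

X-positive⁻ : ∀ {n} (G : Graph n) α → 0ℚ ℚ.< X G α →
  ∃ λ κ → (∀ u → lookup κ u ℕ.< length α) × Proper G κ × HasMonomial α (toList κ)
X-positive⁻ {n} G α pos =
  let κ , κ∈ , p = count-positive⁻ (λ κ → proper? G κ ×-dec hasMonomial? α (toList κ))
                     {words (upTo (length α)) n} pos
  in κ , (λ u → All.lookup (∈-words-upTo⁻ κ κ∈) (∈-toList u κ)) , p

X-nonneg : ∀ {n} (G : Graph n) α → 0ℚ ℚ.≤ X G α
X-nonneg {n} G α = count-nonneg (λ κ → proper? G κ ×-dec hasMonomial? α (toList κ))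
  (words (upTo (length α)) n)

X≮0⇒≡0 : ∀ {n} (G : Graph n) α → ¬ 0ℚ ℚ.< X G α → X G α ≡ 0ℚ
X≮0⇒≡0 G α ≮ = ℚ.≤-antisym (ℚ.≮⇒≥ ≮) (X-nonneg G α)

centre : ∀ m → Fin (suc m)
centre m = fromℕ m

centre-isCentre : ∀ m → IsCentre (centre m)
centre-isCentre m = cong suc (Fin.toℕ-fromℕ m)

-- The colour of the centre is used once, so a star has no colouring with two colours that are
-- both used more than once.
X-star-zero : ∀ m a b → X (starGraph (suc m)) (2 ℕ.+ a ∷ 2 ℕ.+ b ∷ []) ≡ 0ℚ
X-star-zero m a b = X≮0⇒≡0 (starGraph (suc m)) (2 ℕ.+ a ∷ 2 ℕ.+ b ∷ []) λ pos →
  let κ , κ<2 , proper , mono = X-positive⁻ (starGraph (suc m)) (2 ℕ.+ a ∷ 2 ℕ.+ b ∷ []) pos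
      c = lookup κ (centre m)
      j , c≢j , eq = two-occurrences⁻ κ (centre m) refl
        (many κ mono c (κ<2 (centre m)))
  in proper (centre m) j (c≢j , inj₁ (centre-isCentre m)) (sym eq)
  where
  many : ∀ κ → HasMonomial (2 ℕ.+ a ∷ 2 ℕ.+ b ∷ []) (toList {n = suc m} κ) →
         ∀ c → c ℕ.< 2 → 2 ℕ.≤ occ c (toList κ)
  many κ mono zero _ = subst (2 ℕ.≤_) (sym (List.∷-injectiveˡ mono)) (ℕ.m≤m+n 2 a)
  many κ mono (suc zero) _ =
    subst (2 ℕ.≤_) (sym (List.∷-injectiveˡ (List.∷-injectiveʳ mono))) (ℕ.m≤m+n 2 b)
  many κ mono (suc (suc c)) (ℕ.s<s (ℕ.s<s ()))

-- Recognising a star by its monomials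

StarAt : ∀ {n} → Graph n → Fin n → Set
StarAt G v = ∀ {u w} → (Adj G u w → u ≢ w × (u ≡ v ⊎ w ≡ v)) × (u ≢ w × (u ≡ v ⊎ w ≡ v) → Adj G u w)

module _ {n : ℕ} (H : ConnectedGraph n) where

  private
    G : Graph n
    G = graph H

  star-at : ∀ κ → (∀ u → lookup κ u ℕ.< 2) → Proper G κ → occ 1 (toList κ) ≡ 1 →
            ∀ v → lookup κ v ≡ 1 → StarAt G v
  star-at κ κ<2 proper occ≡1 v κv≡1 = to , from
    where
    leaf : ∀ u → u ≢ v → lookup κ u ≡ 0
    leaf u u≢v with lookup κ u in eq | κ<2 u
    ... | zero        | _ = refl
    ... | suc zero    | _ = contradiction (subst (2 ℕ.≤_) occ≡1 (two-occurrences⁺ κ u v u≢v eq κv≡1))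
                              λ { (ℕ.s≤s ()) }
    ... | suc (suc _) | ℕ.s<s (ℕ.s<s ())

    to : ∀ {u w} → Adj G u w → u ≢ w × (u ≡ v ⊎ w ≡ v)
    to {u} {w} a = (λ u≡w → irrefl G u≡w a) , (case u Fin.≟ v of λ where
      (yes u≡v) → inj₁ u≡v
      (no u≢v)  → case w Fin.≟ v of λ where
        (yes w≡v) → inj₂ w≡v
        (no w≢v)  → contradiction (trans (leaf u u≢v) (sym (leaf w w≢v))) (proper u w a))

    -- Every edge has `v` as an end, so the first edge of a walk that starts elsewhere already leads
    -- to `v`.
    first-step : ∀ {u} → u ≢ v → Star (Adj G) u v → Adj G u v
    first-step u≢v ε = contradiction refl u≢v
    first-step u≢v (a ◅ _) with proj₂ (to a)
    ... | inj₁ u≡v  = contradiction u≡v u≢v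
    ... | inj₂ refl = a

    from : ∀ {u w} → u ≢ w × (u ≡ v ⊎ w ≡ v) → Adj G u w
    from {u} {w} (u≢w , inj₁ refl) = symm G (first-step (u≢w ∘ sym) (connected H w v))
    from {u} {w} (u≢w , inj₂ refl) = first-step u≢w (connected H u v)

  star-from-X : ∀ a → 0ℚ ℚ.< X G (a ∷ 1 ∷ []) → ∃ λ v → StarAt G v
  star-from-X a pos = found (X-positive⁻ G (a ∷ 1 ∷ []) pos)
    where
    found : (∃ λ κ → (∀ u → lookup κ u ℕ.< 2) × Proper G κ × HasMonomial (a ∷ 1 ∷ []) (toList κ)) →
            ∃ λ v → StarAt G v
    found (κ , κ<2 , proper , mono) =
      let occ≡1 = List.∷-injectiveˡ (List.∷-injectiveʳ mono)
          v , κv≡1 = ∈-toList⁻ κ (occ-pos⁻ {1} {toList κ} (ℕ.≤-reflexive (sym occ≡1)))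
      in v , star-at κ κ<2 proper occ≡1 v κv≡1

-- Invariance of X under isomorphism

relabel : ∀ {n} → (Fin n → Fin n) → Vec ℕ n → Vec ℕ n
relabel ρ κ = tabulate (lookup κ ∘ ρ)

toList-tabulate : ∀ {n} (f : Fin n → ℕ) → toList (tabulate f) ≡ map f (allFin n)
toList-tabulate f = trans (go f) (sym (List.map-tabulate id f))
  where
  go : ∀ {n} (f : Fin n → ℕ) → toList (tabulate f) ≡ L.tabulate f
  go {zero}  f = refl
  go {suc n} f = cong (f zero ∷_) (go (f ∘ suc))

module _ {n : ℕ} (π ρ : Fin n → Fin n) (π∘ρ : ∀ i → π (ρ i) ≡ i) (ρ∘π : ∀ i → ρ (π i) ≡ i) where

  toList-relabel : ∀ κ → toList (relabel ρ κ) ↭ toList κ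
  toList-relabel κ = subst₂ _↭_
    (trans (sym (List.map-∘ (allFin n))) (sym (toList-tabulate (lookup κ ∘ ρ))))
    (trans (sym (toList-tabulate (lookup κ))) (cong toList (Vec.tabulate∘lookup κ)))
    (↭.map⁺ (lookup κ) (unique-↭ (Unique.map⁺ ρ-inj (Unique.allFin⁺ n)) (Unique.allFin⁺ n)
      (λ {i} _ → ∈-allFin i)
      (λ {i} _ → subst (_∈ map ρ (allFin n)) (ρ∘π i) (∈-map⁺ ρ (∈-allFin (π i))))))
    where
    ρ-inj : ∀ {i j} → ρ i ≡ ρ j → i ≡ j
    ρ-inj {i} {j} eq = trans (sym (π∘ρ i)) (trans (cong π eq) (π∘ρ j))

  relabel-inverse : ∀ κ → relabel π (relabel ρ κ) ≡ κ
  relabel-inverse κ = trans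
    (Vec.tabulate-cong λ i → trans (Vec.lookup∘tabulate (lookup κ ∘ ρ) (π i))
      (cong (lookup κ) (ρ∘π i)))
    (Vec.tabulate∘lookup κ)

module _ {n : ℕ} (α : List ℕ) where

  colourings : Graph n → List (Vec ℕ n)
  colourings G =
    filter (λ κ → proper? G κ ×-dec hasMonomial? α (toList κ)) (words (upTo (length α)) n)

  colourings-unique : ∀ G → Unique (colourings G)
  colourings-unique G = Unique.filter⁺ _ (words-unique (Unique.upTo⁺ (length α)) n)

  -- Colourings are pulled back along `ρ`, so properness on `H` requires `ρ` to send edges of `H` to
  -- edges of `G`. The bijection only permutes the list of colours, which preserves the monomial.
  relabel-colouring : ∀ (G H : Graph n) (π ρ : Fin n → Fin n) →
    (∀ i → π (ρ i) ≡ i) → (∀ i → ρ (π i) ≡ i) → (∀ {u w} → Adj H u w → Adj G (ρ u) (ρ w)) →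
    ∀ {κ} → κ ∈ colourings G → relabel ρ κ ∈ colourings H
  relabel-colouring G H π ρ π∘ρ ρ∘π hom {κ} κ∈ =
    let κ∈′ , proper , mono = ∈-filter⁻ _ {xs = words (upTo (length α)) n} κ∈
        perm = toList-relabel π ρ π∘ρ ρ∘π κ
    in ∈-filter⁺ _
      (∈-words-upTo⁺ (relabel ρ κ) (↭.All-resp-↭ (↭-sym perm) (∈-words-upTo⁻ κ κ∈′)))
      ((λ u w a eq → proper (ρ u) (ρ w) (hom a) (trans (sym (Vec.lookup∘tabulate (lookup κ ∘ ρ) u))
          (trans eq (Vec.lookup∘tabulate (lookup κ ∘ ρ) w)))) ,
       trans (List.map-cong (λ c → ↭.↭-length (↭.filter-↭ (c ℕ.≟_) perm)) (upTo (length α))) mono)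

X-iso : ∀ {n} (G H : Graph n) (π ρ : Fin n → Fin n) →
  (∀ i → π (ρ i) ≡ i) → (∀ i → ρ (π i) ≡ i) →
  (∀ {u w} → Adj G u w → Adj H (π u) (π w)) → (∀ {u w} → Adj H u w → Adj G (ρ u) (ρ w)) →
  X G ≗ X H
X-iso G H π ρ π∘ρ ρ∘π homG homH α = cong fromℕℚ (trans
  (sym (List.length-map (relabel ρ) (colourings α G)))
  (↭.↭-length (unique-↭ (Unique.map⁺ relabel-inj (colourings-unique α G)) (colourings-unique α H)
    (λ p → case ∈-map⁻ (relabel ρ) p of λ where
      (κ , κ∈ , refl) → relabel-colouring α G H π ρ π∘ρ ρ∘π homH κ∈)
    (λ {κ} κ∈ → subst (_∈ map (relabel ρ) (colourings α G)) (relabel-inverse ρ π ρ∘π π∘ρ κ)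
      (∈-map⁺ (relabel ρ) (relabel-colouring α H G ρ π ρ∘π π∘ρ homG κ∈))))))
  where
  relabel-inj : ∀ {κ κ′} → relabel ρ κ ≡ relabel ρ κ′ → κ ≡ κ′
  relabel-inj {κ} {κ′} eq = trans (sym (relabel-inverse π ρ π∘ρ ρ∘π κ))
    (trans (cong (relabel π) eq) (relabel-inverse π ρ π∘ρ ρ∘π κ′))

transpose-left : ∀ {n} (i j : Fin n) → transpose i j i ≡ j
transpose-left i j with i Fin.≟ i
... | yes _  = refl
... | no i≢i = contradiction refl i≢i

starGraph-at : ∀ m → StarAt (starGraph (suc m)) (centre m)
starGraph-at m = (λ (u≢w , c) → u≢w , to c) , (λ (u≢w , c) → u≢w , from c)
  where
  to : ∀ {u w} → IsCentre u ⊎ IsCentre w → u ≡ centre m ⊎ w ≡ centre m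
  to (inj₁ c) = inj₁ (centre-unique c (centre-isCentre m))
  to (inj₂ c) = inj₂ (centre-unique c (centre-isCentre m))
  from : ∀ {u w} → u ≡ centre m ⊎ w ≡ centre m → IsCentre u ⊎ IsCentre w
  from (inj₁ refl) = inj₁ (centre-isCentre m)
  from (inj₂ refl) = inj₂ (centre-isCentre m)

-- `StarAt` determines adjacency by the centre alone, so the transposition exchanging the two
-- centres is an isomorphism.
stars-X : ∀ {n} (G H : Graph n) {v w} → StarAt G v → StarAt H w → X G ≗ X H
stars-X G H {v} {w} starG starH = X-iso G H (transpose v w) (transpose w v)
  (λ i → transpose-inverse v w) (λ i → transpose-inverse w v)
  (hom G H starG starH) (hom H G starH starG)
  where
  hom : ∀ (G H : Graph _) {v w} → StarAt G v → StarAt H w →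
        ∀ {i j} → Adj G i j → Adj H (transpose v w i) (transpose v w j)
  hom G H {v} {w} starG starH {i} {j} a = proj₂ starH
    ( (λ eq → proj₁ (proj₁ starG a) (trans (sym (transpose-inverse w v {i}))
        (trans (cong (transpose w v) eq) (transpose-inverse w v {j}))))
    , (case proj₂ (proj₁ starG a) of λ where
        (inj₁ refl) → inj₁ (transpose-left v w)
        (inj₂ refl) → inj₂ (transpose-left v w)))

-- Schur positivity and obstructions to comparability

ratio-positive : ∀ {p q} → 0ℚ ℚ.< p → 0ℚ ℚ.< q → 0ℚ ℚ.< ratio p q
ratio-positive {p} {q} 0<p 0<q with q ℚ.≟ 0ℚ
... | yes refl = contradiction 0<q (ℚ.<-irrefl refl)
... | no q≢0   = ℚ.positive⁻¹ _
  {{ℚ.pos*pos⇒pos p {{ℚ.positive 0<p}} _ {{ℚ.1/pos⇒pos q {{ℚ.positive 0<q}}}}}}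

*-nonneg : ∀ {p q} → 0ℚ ℚ.≤ p → 0ℚ ℚ.≤ q → 0ℚ ℚ.≤ p ℚ.* q
*-nonneg {p} {q} 0≤p 0≤q = ℚ.nonNegative⁻¹ _
  {{ℚ.nonNeg*nonNeg⇒nonNeg p {{ℚ.nonNegative 0≤p}} q {{ℚ.nonNegative 0≤q}}}}

*-positive : ∀ {p q} → 0ℚ ℚ.< p → 0ℚ ℚ.< q → 0ℚ ℚ.< p ℚ.* q
*-positive {p} {q} 0<p 0<q = ℚ.positive⁻¹ _
  {{ℚ.pos*pos⇒pos p {{ℚ.positive 0<p}} q {{ℚ.positive 0<q}}}}

*-positive⁻ : ∀ {p q} → 0ℚ ℚ.≤ p → 0ℚ ℚ.≤ q → 0ℚ ℚ.< p ℚ.* q → 0ℚ ℚ.< p × 0ℚ ℚ.< q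
*-positive⁻ {p} {q} 0≤p 0≤q 0<pq =
  ℚ.≰⇒> (λ p≤0 → ℚ.<-irrefl refl (subst (0ℚ ℚ.<_)
    (trans (cong (ℚ._* q) (ℚ.≤-antisym p≤0 0≤p)) (ℚ.*-zeroˡ q)) 0<pq)) ,
  ℚ.≰⇒> (λ q≤0 → ℚ.<-irrefl refl (subst (0ℚ ℚ.<_)
    (trans (cong (p ℚ.*_) (ℚ.≤-antisym q≤0 0≤q)) (ℚ.*-zeroʳ p)) 0<pq))

s-nonneg : ∀ μ α → 0ℚ ℚ.≤ s μ α
s-nonneg μ α = count-nonneg _ (fillings (length α) μ)

module _ {n : ℕ} {F : Series} (positive : SchurPositive n F) where

  private
    e : SchurExpansion n F
    e = proj₁ positive

    e≥0 : ∀ μ → μ ⊢ n → 0ℚ ℚ.≤ coeff e μ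
    e≥0 = proj₂ positive

    term-nonneg : ∀ α {μ} → μ ∈ partitions n → 0ℚ ℚ.≤ coeff e μ ℚ.* s μ α
    term-nonneg α {μ} μ∈ = *-nonneg (e≥0 μ (∈-partitions⁻ n μ∈)) (s-nonneg μ α)

  schurPositive-nonneg : ∀ α → 0ℚ ℚ.≤ F α
  schurPositive-nonneg α =
    subst (0ℚ ℚ.≤_) (sym (expands e α)) (⅀-nonneg (partitions n) (term-nonneg α))

  -- A positive value at α comes from some μ whose coefficient and Kostka number at α are both
  -- positive. The same μ contributes positively at β, where nonnegative terms cannot cancel it.
  schurPositive-mono : ∀ α β → (∀ μ → μ ⊢ n → 0ℚ ℚ.< s μ α → 0ℚ ℚ.< s μ β) → 0ℚ ℚ.< F α → 0ℚ ℚ.< F β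
  schurPositive-mono α β α⇒β pos =
    let μ , μ∈ , p = ⅀-pos-witness {f = λ μ → coeff e μ ℚ.* s μ α} (partitions n)
                       (subst (0ℚ ℚ.<_) (expands e α) pos)
        μ⊢n = ∈-partitions⁻ n μ∈
        pe , ps = *-positive⁻ (e≥0 μ μ⊢n) (s-nonneg μ α) p
    in subst (0ℚ ℚ.<_) (sym (expands e β)) (⅀-positive (partitions n) (term-nonneg β) μ∈
         (*-positive pe (α⇒β μ μ⊢n ps)))

module _ {n : ℕ} (G H : ConnectedGraph n)
  (a : SchurExpansion n (X (graph G))) (b : SchurExpansion n (X (graph H))) where

  private
    r : ℚ
    r = ratio (coeff a (replicate n 1)) (coeff b (replicate n 1))

    0<r : 0ℚ ℚ.< r
    0<r = ratio-positive (coeff-1ⁿ-positive (graph G) a) (coeff-1ⁿ-positive (graph H) b)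

  Xₛ-positive : ∀ α → 0ℚ ℚ.< X (graph G) α → X (graph H) α ≡ 0ℚ → 0ℚ ℚ.< Xₛ (graph G) (graph H) a b α
  Xₛ-positive α pos X≡0 = subst (0ℚ ℚ.<_) (sym (trans
    (cong (λ x → X (graph G) α ℚ.- x) (trans (cong (r ℚ.*_) X≡0) (ℚ.*-zeroʳ r)))
    (ℚ.+-identityʳ (X (graph G) α)))) pos

  Xₛ-nonpos : ∀ α → X (graph G) α ≡ 0ℚ → Xₛ (graph G) (graph H) a b α ℚ.≤ 0ℚ
  Xₛ-nonpos α X≡0 = subst (ℚ._≤ 0ℚ)
    (sym (trans (cong (ℚ._- r ℚ.* X (graph H) α) X≡0) (ℚ.+-identityˡ (ℚ.- (r ℚ.* X (graph H) α)))))
    (ℚ.neg-antimono-≤ (*-nonneg (ℚ.<⇒≤ 0<r) (X-nonneg (graph H) α)))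

  Xₛ-negative : ∀ α → X (graph G) α ≡ 0ℚ → 0ℚ ℚ.< X (graph H) α → Xₛ (graph G) (graph H) a b α ℚ.< 0ℚ
  Xₛ-negative α X≡0 pos = subst (ℚ._< 0ℚ)
    (sym (trans (cong (ℚ._- r ℚ.* X (graph H) α) X≡0) (ℚ.+-identityˡ (ℚ.- (r ℚ.* X (graph H) α)))))
    (ℚ.neg-antimono-< (*-positive 0<r pos))

≱ₛ-by-zero : ∀ {n} (G H : ConnectedGraph n) α →
  X (graph G) α ≡ 0ℚ → 0ℚ ℚ.< X (graph H) α → ¬ G ≥ₛ H
≱ₛ-by-zero G H α X≡0 pos (a , b , schur) = ℚ.<-irrefl refl
  (ℚ.≤-<-trans (schurPositive-nonneg schur α) (Xₛ-negative G H a b α X≡0 pos))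

-- Subtracting a multiple of X_H leaves the value at α untouched and makes the one at β at most 0,
-- while Schur positivity would carry positivity from α to β.
≱ₛ-by-dominance : ∀ {n} (G H : ConnectedGraph n) α β →
  (∀ μ → μ ⊢ n → 0ℚ ℚ.< s μ α → 0ℚ ℚ.< s μ β) →
  0ℚ ℚ.< X (graph G) α → X (graph H) α ≡ 0ℚ → X (graph G) β ≡ 0ℚ → ¬ G ≥ₛ H
≱ₛ-by-dominance G H α β α⇒β pos X≡0 X≡0′ (a , b , schur) = ℚ.<-irrefl refl
  (ℚ.<-≤-trans (schurPositive-mono schur α β α⇒β (Xₛ-positive G H a b α pos X≡0))
    (Xₛ-nonpos G H a b β X≡0′))

X-nonstar : ∀ m (H : ConnectedGraph (suc m)) → ¬ (X (graph H) ≗ X (starGraph (suc m))) →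
            X (graph H) (m ∷ 1 ∷ []) ≡ 0ℚ
X-nonstar m H H≉S = X≮0⇒≡0 (graph H) (m ∷ 1 ∷ []) λ pos →
  let v , star = star-from-X H m pos in
  H≉S (stars-X (graph H) (starGraph (suc m)) star (starGraph-at m))

proposition4p12 : (n : ℕ) → n ≥ 4 → Independent (𝒮 n) (starC n)
proposition4p12 (suc (suc (suc (suc m)))) (ℕ.s≤s (ℕ.s≤s (ℕ.s≤s (ℕ.s≤s _)))) H H≉S (inj₁ S≥H) =
  ≱ₛ-by-dominance (starC (4 ℕ.+ m)) H (3 ℕ.+ m ∷ 1 ∷ []) (2 ℕ.+ m ∷ 2 ∷ []) (kostka-positive m)
    -- The exponents n - 2 and 2 are 2 + m and 2 + 0, hence the last two arguments `m` and `0` of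
    -- `X-star-zero`.
    (X-star-positive (3 ℕ.+ m)) (X-nonstar (3 ℕ.+ m) H H≉S) (X-star-zero (3 ℕ.+ m) m 0) S≥H
proposition4p12 (suc (suc (suc (suc m)))) (ℕ.s≤s (ℕ.s≤s (ℕ.s≤s (ℕ.s≤s _)))) H H≉S (inj₂ H≥S) =
  ≱ₛ-by-zero H (starC (4 ℕ.+ m)) (3 ℕ.+ m ∷ 1 ∷ [])
    (X-nonstar (3 ℕ.+ m) H H≉S) (X-star-positive (3 ℕ.+ m)) H≥S
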